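{- Let $n\ge2$, $b\ge2$. Let $\mu_1,\mu_2,\dots$ be i.i.d. random permutations in $S_n$ with law $Q_b$, and define $\tau_0=\mathrm{id}$ and $\tau_r=\tau_{r-1}\circ\mu_r$ (i.e. $\tau_r(p)=\tau_{r-1}(\mu_r(p))$), the arrangement after $r$ successive $b$-shuffles. Then $(d(\tau_r^{ -1}))_{r\ge0}$ is a Markov chain on $\{0,\dots,n-1\}$ with stationary distribution $\pi(j)=A(n,j)/n!$, and its transition matrix $K$ satisfies $K(i,j)=\pi(j)P_b(j,i)/\pi(i)$ for all $i,j$; that is, the formal time reversal of this chain with respect to $\pi$ is exactly the base-$b$ carries chain $P_b$.
   Context: For $\sigma\in S_n$, $\sigma$ has a descent at $i$ ($1\le i\le n-1$) if $\sigma(i+1)<\sigma(i)$; $d(\sigma)$ is the number of descents, and $A(n,j)$ (Eulerian number) is the number of $\sigma\in S_n$ with $d(\sigma)=j$. Binomial convention: $\binom{m}{n}=\frac{m(m-1)\cdots(m-n+1)}{n!}$ if $m\ge n$, and $0$ if $m<n$. The $b$-shuffle measure is $Q_b(\sigma)=\binom{n+b-d(\sigma^{ -1})-1}{n}/b^n$ on $S_n$. The base-$b$ carries chain for adding $n$ numbers is the Markov chain on $\{0,\dots,n-1\}$ given by $\kappa_0=0$, $\kappa_{t+1}=\lfloor(\kappa_t+X_{t+1,1}+\dots+X_{t+1,n})/b\rfloor$ with $X_{t,k}$ i.i.d. uniform on $\{0,\dots,b-1\}$; its transition matrix is $P_b(i,j)=b^{ -n}\sum_{l=0}^{j-\lfloor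 i/b\rfloor}(-1)^l\binom{n+1}{l}\binom{n-1-i+(j+1-l)b}{n}$. -}

module Defs where

open import Data.Fin.Base as Fin using (Fin; zero; suc; toℕ; fromℕ; fromℕ<; inject₁; punchIn)
import Data.Fin.Properties as Fin
open import Data.Fin.Permutation as Perm
  using (Permutation′; _⟨$⟩ʳ_; _∘ₚ_; flip; insert; insert-punchIn)
open import Data.Fin.Subset using (Subset; ∣_∣)
open import Data.Fin.Subset.Properties using (∣p∣≤n)
open import Data.Integer.Base as ℤ using (ℤ; +_; 0ℤ; -1ℤ)
open import Data.List.Base as List
  using (List; []; _∷_; filter; length; upTo; allFin; cartesianProductWith)
open import Data.List.Membership.Propositional using (_∈_)
open import Data.List.Membership.Propositional.Properties
  using (∈-filter⁺; ∈-length; ∈-allFin; ∈-cartesianProductWith⁺)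
open import Data.List.Relation.Unary.Any using (here)
open import Data.Nat.Base as ℕ
  using (ℕ; zero; suc; _+_; _*_; _∸_; _^_; _!; _≤_; _<_; z≤n; s≤s;
         NonZero; >-nonZero; >-nonZero⁻¹)
open import Data.Nat.Combinatorics using (_C_)
open import Data.Nat.DivMod using (m<n*o⇒m/o<n)
import Data.Nat.Properties as ℕ
open import Data.Product.Base using (∃; _×_; _,_)
open import Data.Rational.Base as ℚ using (ℚ; 0ℚ; 1ℚ)
import Data.Rational.Properties as ℚ
open import Data.Vec.Base as Vec using (Vec; []; _∷_; _∷ʳ_; last; tabulate)
import Data.Vec.Properties as Vec
open import Function.Base using (const)
open import Function.Bundles using (mk⇔)
open import Level using (0ℓ)
open import Relation.Binary.PropositionalEquality
  using (_≡_; refl; sym; trans; cong; cong₂; subst)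
open import Relation.Nullary.Decidable using (does; does-⇔; dec-true; dec-false)
open import Relation.Unary using (Pred; Decidable)

open import Algebra.Properties.CommutativeMonoid.Sum ℚ.+-0-commutativeMonoid public
  using (sum)

private
  variable
    A S : Set

------------------------------------------------------------------------
-- Permutations and descents

-- Every σ ∈ Sₙ₊₁ is determined by σ(0) and the permutation of n points that
-- remains once 0 and σ(0) are removed, so each permutation is listed once.
perms : ∀ n → List (Permutation′ n)
perms zero    = Perm.id ∷ []
perms (suc n) = cartesianProductWith (insert zero) (allFin (suc n)) (perms n)

descentSet : ∀ {m} → Permutation′ (suc m) → Subset m
descentSet σ = tabulate λ i → does (σ ⟨$⟩ʳ suc i Fin.<? σ ⟨$⟩ʳ inject₁ i)

d : ∀ {n} → Permutation′ n → ℕ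
d {zero}  σ = 0
d {suc m} σ = ∣ descentSet σ ∣

d<n : ∀ {n} .{{_ : NonZero n}} (σ : Permutation′ n) → d σ < n
d<n {suc m} σ = s≤s (∣p∣≤n (descentSet σ))

eulerian : ℕ → ℕ → ℕ
eulerian n j = length (filter (λ σ → d σ ℕ.≟ j) (perms n))

------------------------------------------------------------------------
-- Finite probability

-- A finitely supported weighting; total mass 1 is not part of the structure.
record Law (A : Set) : Set where
  field
    outcomes : List A
    mass     : A → ℚ

open Law public

sumℚ : List ℚ → ℚ
sumℚ = List.foldr ℚ._+_ 0ℚ

Pr : (L : Law A) {P : Pred A 0ℓ} → Decidable P → ℚ
Pr L P? = sumℚ (List.map (mass L) (filter P? (outcomes L)))

tuples : ∀ r → List A → List (Vec A r)
tuples zero    xs = [] ∷ []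
tuples (suc r) xs = cartesianProductWith _∷_ xs (tuples r xs)

iid : ∀ r → Law A → Law (Vec A r)
iid r L = record
  { outcomes = tuples r (outcomes L)
  ; mass     = Vec.foldr (λ _ → ℚ) (λ x q → mass L x ℚ.* q) 1ℚ
  }

uniform : ∀ b .{{_ : NonZero b}} → Law (Fin b)
uniform b = record { outcomes = allFin b ; mass = const (+ 1 ℚ./ b) }

-- The states s₀, s₁, …, sᵣ visited under successive inputs x₁, …, xᵣ.
trajectory : ∀ {r} → (S → A → S) → S → Vec A r → Vec S (suc r)
trajectory step s []       = s ∷ []
trajectory step s (x ∷ xs) = s ∷ trajectory step (step s x) xs

-- A process X₀, X₁, … with values in {0,…,n-1}, given by its
-- finite-dimensional distributions P(X₀ = i₀, …, Xᵣ = iᵣ).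
Process : ℕ → Set
Process n = ∀ r → Vec (Fin n) (suc r) → ℚ

-- Xₜ = obs sₜ, where s₀ = start, sₜ₊₁ = step sₜ xₜ₊₁ and x₁, x₂, … are i.i.d.
-- with law L.  Only x₁, …, xᵣ matter for X₀, …, Xᵣ.
driven : ∀ {n} → Law A → (step : S → A → S) (start : S) (obs : S → Fin n) → Process n
driven L step start obs r path =
  Pr (iid r L) λ xs → Vec.≡-dec Fin._≟_ (Vec.map obs (trajectory step start xs)) path

Matrix : ℕ → Set
Matrix n = Fin n → Fin n → ℚ

record IsDistribution {n} (p : Fin n → ℚ) : Set where
  field
    nonNegative : ∀ i → 0ℚ ℚ.≤ p i
    total       : sum p ≡ 1ℚ

-- The Markov property is written with the conditional probability multiplied
-- out, so that conditioning on null events imposes nothing.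
record IsMarkovChain {n} (X : Process n) (K : Matrix n) : Set where
  field
    stochastic : ∀ i → IsDistribution (K i)
    markov     : ∀ r (path : Vec (Fin n) (suc r)) (j : Fin n) →
                 X (suc r) (path ∷ʳ j) ≡ X r path ℚ.* K (last path) j

record IsStationary {n} (p : Fin n → ℚ) (K : Matrix n) : Set where
  field
    isDistribution : IsDistribution p
    invariant      : ∀ j → sum (λ i → p i ℚ.* K i j) ≡ p j

reversal : ∀ {n} (p : Fin n → ℚ) → (∀ i → ℚ.NonZero (p i)) → Matrix n → Matrix n
reversal p p≢0 K i j = ((p j ℚ.* K j i) ℚ.÷ p i) {{p≢0 i}}

------------------------------------------------------------------------
-- Descents after repeated b-shuffles

Q : ∀ n b .{{_ : NonZero b}} → Permutation′ n → ℚ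
Q n b σ = ((+ ((n + b ∸ d (flip σ) ∸ 1) C n)) ℚ./ (b ^ n)) {{ℕ.m^n≢0 b n}}

shuffleLaw : ∀ n b .{{_ : NonZero b}} → Law (Permutation′ n)
shuffleLaw n b = record { outcomes = perms n ; mass = Q n b }

-- _∘ₚ_ composes diagrammatically: (μ ∘ₚ τ) ⟨$⟩ʳ p = τ ⟨$⟩ʳ (μ ⟨$⟩ʳ p).
shuffle : ∀ {n} → Permutation′ n → Permutation′ n → Permutation′ n
shuffle τ μ = μ ∘ₚ τ

shuffleDescents : ∀ n b .{{_ : NonZero n}} .{{_ : NonZero b}} → Process n
shuffleDescents n b = driven (shuffleLaw n b) shuffle Perm.id (λ τ → fromℕ< (d<n (flip τ)))

------------------------------------------------------------------------
-- Carries

module _ {n b} .{{_ : NonZero n}} .{{_ : NonZero b}} where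

  private
    sum-digits : ∀ {k} (x : Vec (Fin b) k) → Vec.sum (Vec.map toℕ x) + k ≤ k * b
    sum-digits []      = z≤n
    sum-digits {suc k} (x ∷ xs) = begin
      toℕ x + s + suc k     ≡⟨ ℕ.+-suc (toℕ x + s) k ⟩
      suc (toℕ x + s + k)   ≡⟨ cong suc (ℕ.+-assoc (toℕ x) s k) ⟩
      suc (toℕ x) + (s + k) ≤⟨ ℕ.+-mono-≤ (Fin.toℕ<n x) (sum-digits xs) ⟩
      b + k * b             ∎
      where
      open ℕ.≤-Reasoning
      s = Vec.sum (Vec.map toℕ xs)

  carry< : (κ : Fin n) (x : Vec (Fin b) n) → (toℕ κ + Vec.sum (Vec.map toℕ x)) ℕ./ b < n
  carry< κ x = m<n*o⇒m/o<n (ℕ.<-≤-trans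
    (subst (toℕ κ + s <_) (ℕ.+-comm n s) (ℕ.+-monoˡ-< s (Fin.toℕ<n κ)))
    (sum-digits x))
    where s = Vec.sum (Vec.map toℕ x)

  addColumn : Fin n → Vec (Fin b) n → Fin n
  addColumn κ x = fromℕ< (carry< κ x)

carries : ∀ n b .{{_ : NonZero n}} .{{_ : NonZero b}} → Process n
carries n b = driven (iid n (uniform b)) addColumn (fromℕ< (>-nonZero⁻¹ n)) (λ κ → κ)

sumℤ : List ℤ → ℤ
sumℤ = List.foldr ℤ._+_ 0ℤ

carryTerm : (n b i j l : ℕ) → ℤ
carryTerm n b i j l =
  -1ℤ ℤ.^ l ℤ.* + ((n + 1) C l) ℤ.* + ((n ∸ 1 ∸ i + (j + 1 ∸ l) * b) C n)

-- l runs through 0 ≤ l < j + 1 ∸ ⌊i/b⌋, which is empty when j < ⌊i/b⌋.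
P : ∀ n b .{{_ : NonZero b}} → Matrix n
P n b i j = (sumℤ (List.map (carryTerm n b (toℕ i) (toℕ j)) (upTo (toℕ j + 1 ∸ toℕ i ℕ./ b)))
  ℚ./ (b ^ n)) {{ℕ.m^n≢0 b n}}

------------------------------------------------------------------------
-- The Eulerian distribution

π : ∀ n → Fin n → ℚ
π n j = (+ eulerian n (toℕ j) ℚ./ n !) {{n ℕ.!≢0}}

private
  punchIn-<-⇔ : ∀ {m} (j : Fin (suc m)) (x y : Fin m) →
                does (punchIn j x Fin.<? punchIn j y) ≡ does (x Fin.<? y)
  punchIn-<-⇔ j x y = does-⇔ (mk⇔
    (λ p → ℕ.≰⇒> λ y≤x → ℕ.<⇒≱ p (Fin.punchIn-mono-≤ j y x y≤x))
    (λ p → ℕ.≰⇒> λ q → ℕ.<⇒≱ p (Fin.punchIn-cancel-≤ j y x q)))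
    (punchIn j x Fin.<? punchIn j y) (x Fin.<? y)

  tail-insert : ∀ {m} j (σ : Permutation′ (suc m)) (i : Fin m) →
                does (insert zero j σ ⟨$⟩ʳ suc (suc i) Fin.<? insert zero j σ ⟨$⟩ʳ inject₁ (suc i))
                ≡ does (σ ⟨$⟩ʳ suc i Fin.<? σ ⟨$⟩ʳ inject₁ i)
  tail-insert j σ i = trans
    (cong₂ (λ x y → does (x Fin.<? y))
      (insert-punchIn zero j σ (suc i)) (insert-punchIn zero j σ (inject₁ i)))
    (punchIn-<-⇔ j _ _)

  d-insert-min : ∀ {m} (σ : Permutation′ (suc m)) → d (insert zero zero σ) ≡ d σ
  d-insert-min {m} σ = cong ∣_∣ (cong₂ _∷_
    (dec-false (insert zero zero σ ⟨$⟩ʳ suc zero Fin.<? zero {m}) λ ())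
    (Vec.tabulate-cong (tail-insert zero σ)))

  d-insert-max : ∀ {m} (σ : Permutation′ (suc m)) → d (insert zero (fromℕ (suc m)) σ) ≡ suc (d σ)
  d-insert-max {m} σ = cong ∣_∣ (cong₂ _∷_
    (dec-true (insert zero ⊤ σ ⟨$⟩ʳ suc zero Fin.<? ⊤)
      (Fin.≤∧≢⇒< (Fin.≤fromℕ (insert zero ⊤ σ ⟨$⟩ʳ suc zero)) λ eq →
        Fin.punchInᵢ≢i ⊤ (σ ⟨$⟩ʳ zero) (trans (sym (insert-punchIn zero ⊤ σ zero)) eq)))
    (Vec.tabulate-cong (tail-insert ⊤ σ)))
    where ⊤ = fromℕ (suc m)

  withDescents : ∀ m k → k ≤ m → ∃ λ σ → σ ∈ perms (suc m) × d σ ≡ k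
  withDescents zero    zero    _ = _ , here refl , refl
  withDescents (suc m) zero    _ = let σ , σ∈ , eq = withDescents m zero z≤n in
    _ , ∈-cartesianProductWith⁺ (insert zero) (∈-allFin zero) σ∈ , trans (d-insert-min σ) eq
  withDescents (suc m) (suc k) (s≤s k≤m) = let σ , σ∈ , eq = withDescents m k k≤m in
    _ , ∈-cartesianProductWith⁺ (insert zero) (∈-allFin (fromℕ (suc m))) σ∈ ,
    trans (d-insert-max σ) (cong suc eq)

eulerian>0 : ∀ {n} (j : Fin n) → 0 < eulerian n (toℕ j)
eulerian>0 {suc m} j = let σ , σ∈ , eq = withDescents m (toℕ j) (ℕ.s≤s⁻¹ (Fin.toℕ<n j)) in
  ∈-length (∈-filter⁺ (λ σ → d σ ℕ.≟ toℕ j) σ∈ eq)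

π-nonZero : ∀ {n} (i : Fin n) → ℚ.NonZero (π n i)
π-nonZero {n} i =
  ℚ.pos⇒nonZero (π n i)
    {{ℚ.normalize-pos (eulerian n (toℕ i)) (n !) {{n ℕ.!≢0}} {{>-nonZero (eulerian>0 i)}}}}

{-# OPTIONS --safe #-}

-- Let G(N) = C(n + N - 1, n) be the number of y ∈ ℕⁿ with Σ y < N.  Writing each
-- entry of y in base b shows that the carries from a carry j satisfy
-- E[G(a - carry)] bⁿ = G(a b - j) for all a.  On the other hand G(a - d(σ)) counts
-- the weakly increasing words of length n over a letters that increase strictly at
-- the descents of σ; sorting words over a × b letters gives
--   Σ_σ G(b - d(x σ⁻¹)) G(a - d(σ)) = G(a b - d(x))  for all a.
-- The functions a ↦ G(a - i) are linearly independent (n + 1 differences isolate i),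
-- so Σ_{d(σ) = i} Q_b(σ x⁻¹) = P_b(d(x), i).  Hence the law of τᵣ given
-- d(τ₀⁻¹), …, d(τᵣ⁻¹) is uniform on the permutations with the last of these values,
-- and the transition matrix follows.

module Submission where

open import Defs
open import Algebra.Structures using (IsCommutativeSemiring; module IsCommutativeRing)
open import Data.Bool.Base using (true; false; if_then_else_)
open import Data.Fin.Base as Fin using (Fin; zero; suc; toℕ; fromℕ<; inject₁; punchOut)
open import Data.Fin.Permutation as Perm
  using (Permutation′; permutation; _⟨$⟩ʳ_; _⟨$⟩ˡ_; _∘ₚ_; flip; inverseˡ; inverseʳ;
         insert; remove; insert-punchIn)
import Data.Fin.Properties as Fin
open import Data.Fin.Subset using (Subset; ∣_∣; _∈_)
import Data.Fin.Subset.Properties as Subset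
open import Data.Integer.Base as ℤ using (ℤ; 0ℤ; 1ℤ; -1ℤ)
import Data.Integer.Properties as ℤ
import Data.Integer.Tactic.RingSolver as ℤ-Solver
open import Data.List.Base as List
  using (List; []; _∷_; _++_; foldr; filter; length; upTo; allFin; cartesianProductWith)
import Data.List.Properties as List
open import Data.Nat.Base as ℕ
  using (ℕ; zero; suc; _∸_; _^_; _!; _≤_; z≤n; s≤s; NonZero)
open import Data.Nat.Combinatorics using (_C_; nCn≡1; nCk+nC[k+1]≡[n+1]C[k+1])
open import Data.Nat.Combinatorics.Specification using (k>n⇒nCk≡0)
open import Data.Nat.Divisibility using (n∣m*n)
import Data.Nat.DivMod as DivMod
import Data.Nat.Properties as ℕ
open import Data.Nat.Tactic.RingSolver using (solve-∀)
open import Data.Product.Base using (_×_; _,_; proj₁; proj₂; ∃; ∃-syntax)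
open import Data.Rational.Base as ℚ using (ℚ; 0ℚ; 1ℚ; fromℚᵘ; toℚᵘ)
import Data.Rational.Properties as ℚ
import Data.Rational.Unnormalised.Base as ℚᵘ
import Data.Rational.Unnormalised.Properties as ℚᵘ
open import Data.Sum.Base using (_⊎_; inj₁; inj₂)
open import Data.Unit.Base using (⊤; tt)
open import Data.Vec.Base as Vec using (Vec; []; _∷_; _∷ʳ_; last; lookup; tabulate)
import Data.Vec.Properties as Vec
open import Function.Base using (_∘_; id)
open import Level using (0ℓ)
open import Relation.Binary.Definitions using (DecidableEquality; tri<; tri≈; tri>)
open import Relation.Binary.PropositionalEquality
  using (_≡_; _≢_; refl; sym; trans; cong; cong₂; subst; subst₂; module ≡-Reasoning)
open import Relation.Nullary using (¬_; Dec; yes; no; does; contradiction; _×-dec_)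
open import Relation.Nullary.Decidable using (dec-true; dec-false)
open import Relation.Unary using (Pred; Decidable)

-- In the product identity x = t⁻¹ belongs to the later arrangement t, which is fixed, and σ = s⁻¹
-- to the earlier one s, which is summed over. So Σ_{d(s⁻¹) = i} Q_b(s⁻¹ t) = P_b(d(t⁻¹), i) tells
-- where a shuffle came from, not where it leads: P_b steps backward in time, and this is how the
-- reversal enters. The identity does not say that all arrangements s with the same d(s⁻¹) have
-- equal chances of reaching j descents. The Markov property is therefore obtained by following the
-- conditional law of the arrangement. That law is uniform at the start because only the identity
-- has no descents, and it stays uniform because the sum over s depends on t through d(t⁻¹) alone.
-- The order n + 1 of the differences is the exponent in Σ_N G(N + 1) x^N = 1/(1 - x)^(n + 1):
-- multiplying by (1 - x)^(n + 1) turns the generating function of a ↦ G(a + 1 - j) into x^j, and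
-- the signed binomials in P_b are the coefficients of that power.

private
  variable
    A B S : Set
    m n : ℕ

-- Permutations are compared pointwise, as without function extensionality
-- pointwise equal ones need not be propositionally equal.
infix 4 _≈?_
_≈?_ : ∀ {n} (σ τ : Permutation′ n) → Dec (σ Perm.≈ τ)
σ ≈? τ = Fin.all? λ i → σ ⟨$⟩ʳ i Fin.≟ τ ⟨$⟩ʳ i

insert-≈⁻ : ∀ {n} {j} {σ : Permutation′ n} {τ} → insert zero j σ Perm.≈ τ →
            j ≡ τ ⟨$⟩ʳ zero × σ Perm.≈ remove zero τ
insert-≈⁻ {j = j} {σ} {τ} eq = eq zero , λ i → Fin.punchIn-injective j _ _ (begin
  Fin.punchIn j (σ ⟨$⟩ʳ i)                              ≡⟨ insert-punchIn zero j σ i ⟨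
  insert zero j σ ⟨$⟩ʳ suc i                            ≡⟨ eq (suc i) ⟩
  τ ⟨$⟩ʳ suc i                                          ≡⟨ Perm.punchIn-permute τ zero i ⟩
  Fin.punchIn (τ ⟨$⟩ʳ zero) (remove zero τ ⟨$⟩ʳ i)
    ≡⟨ cong (λ k → Fin.punchIn k (remove zero τ ⟨$⟩ʳ i)) (eq zero) ⟨
  Fin.punchIn j (remove zero τ ⟨$⟩ʳ i)                  ∎)
  where open ≡-Reasoning

insert-≈⁺ : ∀ {n} {j} {σ : Permutation′ n} {τ} → j ≡ τ ⟨$⟩ʳ zero → σ Perm.≈ remove zero τ →
            insert zero j σ Perm.≈ τ
insert-≈⁺ {j = j} {σ} {τ} refl eq zero    = refl
insert-≈⁺ {j = j} {σ} {τ} refl eq (suc i) = begin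
  insert zero j σ ⟨$⟩ʳ suc i           ≡⟨ insert-punchIn zero j σ i ⟩
  Fin.punchIn j (σ ⟨$⟩ʳ i)             ≡⟨ cong (Fin.punchIn j) (eq i) ⟩
  Fin.punchIn j (remove zero τ ⟨$⟩ʳ i) ≡⟨ Perm.punchIn-permute τ zero i ⟨
  τ ⟨$⟩ʳ suc i                         ∎
  where open ≡-Reasoning

-- Finite sums over lists with values in a commutative semiring

module BigSum {C : Set} {_⊕_ _⊗_ : C → C → C} {𝟎 𝟏 : C}
  (isCommutativeSemiring : IsCommutativeSemiring _≡_ _⊕_ _⊗_ 𝟎 𝟏) where

  open IsCommutativeSemiring isCommutativeSemiring
    using ( +-assoc; +-comm; +-identityˡ; +-identityʳ; *-comm; *-identityˡ; *-identityʳ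
          ; distribˡ; zeroˡ; zeroʳ; +-congˡ; +-congʳ; *-congˡ; *-congʳ )
  open ≡-Reasoning

  -- Opaque so that unification treats ∑ as injective.
  opaque
    ∑ : List A → (A → C) → C
    ∑ xs f = foldr _⊕_ 𝟎 (List.map f xs)

    ∑-foldr : ∀ (xs : List A) f → ∑ xs f ≡ foldr _⊕_ 𝟎 (List.map f xs)
    ∑-foldr xs f = refl

    ∑-[] : ∀ {f : A → C} → ∑ [] f ≡ 𝟎
    ∑-[] = refl

    ∑-∷ : ∀ {f : A → C} {x xs} → ∑ (x ∷ xs) f ≡ f x ⊕ ∑ xs f
    ∑-∷ = refl

  -- The Iverson bracket. Conditions become factors, so that filtered sums can be exchanged and
  -- reindexed like any others.
  ⟦_⟧ : ∀ {P : Set} → Dec P → C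
  ⟦ P? ⟧ = if does P? then 𝟏 else 𝟎

  opaque
    unfolding ∑

    ∑-cong : ∀ (xs : List A) {f g : A → C} → (∀ x → f x ≡ g x) → ∑ xs f ≡ ∑ xs g
    ∑-cong xs eq = cong (foldr _⊕_ 𝟎) (List.map-cong eq xs)

    ∑-zero : ∀ (xs : List A) → ∑ xs (λ _ → 𝟎) ≡ 𝟎
    ∑-zero []       = refl
    ∑-zero (x ∷ xs) = trans (+-identityˡ _) (∑-zero xs)

    ∑-++ : ∀ (xs ys : List A) f → ∑ (xs ++ ys) f ≡ ∑ xs f ⊕ ∑ ys f
    ∑-++ []       ys f = sym (+-identityˡ _)
    ∑-++ (x ∷ xs) ys f = trans (cong (f x ⊕_) (∑-++ xs ys f)) (sym (+-assoc _ _ _))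

    ∑-map : ∀ (g : A → B) xs f → ∑ (List.map g xs) f ≡ ∑ xs (f ∘ g)
    ∑-map g xs f = cong (foldr _⊕_ 𝟎) (sym (List.map-∘ xs))

    ∑-⊕ : ∀ (xs : List A) f g → ∑ xs (λ x → f x ⊕ g x) ≡ ∑ xs f ⊕ ∑ xs g
    ∑-⊕ []       f g = sym (+-identityˡ _)
    ∑-⊕ (x ∷ xs) f g = begin
      (f x ⊕ g x) ⊕ ∑ xs (λ x → f x ⊕ g x) ≡⟨ cong ((f x ⊕ g x) ⊕_) (∑-⊕ xs f g) ⟩
      (f x ⊕ g x) ⊕ (∑ xs f ⊕ ∑ xs g)      ≡⟨ +-assoc _ _ _ ⟩
      f x ⊕ (g x ⊕ (∑ xs f ⊕ ∑ xs g))      ≡⟨ cong (f x ⊕_) (sym (+-assoc _ _ _)) ⟩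
      f x ⊕ ((g x ⊕ ∑ xs f) ⊕ ∑ xs g)      ≡⟨ cong (λ z → f x ⊕ (z ⊕ ∑ xs g)) (+-comm _ _) ⟩
      f x ⊕ ((∑ xs f ⊕ g x) ⊕ ∑ xs g)      ≡⟨ cong (f x ⊕_) (+-assoc _ _ _) ⟩
      f x ⊕ (∑ xs f ⊕ (g x ⊕ ∑ xs g))      ≡⟨ sym (+-assoc _ _ _) ⟩
      (f x ⊕ ∑ xs f) ⊕ (g x ⊕ ∑ xs g)      ∎

    ⊗-∑ : ∀ c (xs : List A) f → c ⊗ ∑ xs f ≡ ∑ xs (λ x → c ⊗ f x)
    ⊗-∑ c []       f = zeroʳ c
    ⊗-∑ c (x ∷ xs) f = trans (distribˡ c _ _) (cong ((c ⊗ f x) ⊕_) (⊗-∑ c xs f))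

    ∑-⊗ : ∀ (xs : List A) f c → ∑ xs f ⊗ c ≡ ∑ xs (λ x → f x ⊗ c)
    ∑-⊗ xs f c = begin
      ∑ xs f ⊗ c           ≡⟨ *-comm _ c ⟩
      c ⊗ ∑ xs f           ≡⟨ ⊗-∑ c xs f ⟩
      ∑ xs (λ x → c ⊗ f x) ≡⟨ ∑-cong xs (λ x → *-comm c (f x)) ⟩
      ∑ xs (λ x → f x ⊗ c) ∎

    ∑-swap : ∀ (xs : List A) (ys : List B) (f : A → B → C) →
             ∑ xs (λ x → ∑ ys (f x)) ≡ ∑ ys (λ y → ∑ xs (λ x → f x y))
    ∑-swap []       ys f = sym (∑-zero ys)
    ∑-swap (x ∷ xs) ys f = begin
      ∑ ys (f x) ⊕ ∑ xs (λ x → ∑ ys (f x))           ≡⟨ cong (∑ ys (f x) ⊕_) (∑-swap xs ys f) ⟩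
      ∑ ys (f x) ⊕ ∑ ys (λ y → ∑ xs (λ x → f x y))   ≡⟨ ∑-⊕ ys (f x) _ ⟨
      ∑ ys (λ y → f x y ⊕ ∑ xs (λ x → f x y))        ∎

    ∑-cartesianProductWith : ∀ (g : A → B → S) xs ys f →
      ∑ (cartesianProductWith g xs ys) f ≡ ∑ xs (λ x → ∑ ys (λ y → f (g x y)))
    ∑-cartesianProductWith g []       ys f = refl
    ∑-cartesianProductWith g (x ∷ xs) ys f = begin
      ∑ (List.map (g x) ys ++ cartesianProductWith g xs ys) f
        ≡⟨ ∑-++ (List.map (g x) ys) _ f ⟩
      ∑ (List.map (g x) ys) f ⊕ ∑ (cartesianProductWith g xs ys) f
        ≡⟨ cong₂ _⊕_ (∑-map (g x) ys f) (∑-cartesianProductWith g xs ys f) ⟩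
      ∑ ys (f ∘ g x) ⊕ ∑ xs (λ x → ∑ ys (λ y → f (g x y))) ∎

    ∑-filter : ∀ {P : Pred A 0ℓ} (P? : Decidable P) xs f →
               ∑ (filter P? xs) f ≡ ∑ xs (λ x → ⟦ P? x ⟧ ⊗ f x)
    ∑-filter P? []       f = refl
    ∑-filter P? (x ∷ xs) f with does (P? x)
    ... | true  = cong₂ _⊕_ (sym (*-identityˡ _)) (∑-filter P? xs f)
    ... | false = trans (∑-filter P? xs f)
                    (sym (trans (+-congʳ (zeroˡ (f x))) (+-identityˡ _)))

  ∑-singleton : ∀ {f : A → C} {x} → ∑ (x ∷ []) f ≡ f x
  ∑-singleton = trans ∑-∷ (trans (+-congˡ ∑-[]) (+-identityʳ _))

  ∑-upTo-suc : ∀ n f → ∑ (upTo (suc n)) f ≡ f 0 ⊕ ∑ (upTo n) (f ∘ suc)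
  ∑-upTo-suc n f = trans ∑-∷ (cong (f 0 ⊕_) (trans
    (cong (λ xs → ∑ xs f) (sym (List.map-upTo suc n))) (∑-map suc (upTo n) f)))

  ∑-allFin-suc : ∀ n f → ∑ (allFin (suc n)) f ≡ f zero ⊕ ∑ (allFin n) (f ∘ suc)
  ∑-allFin-suc n f = trans ∑-∷ (cong (f zero ⊕_) (trans
    (cong (λ xs → ∑ xs f) (sym (List.map-tabulate id suc))) (∑-map suc (allFin n) f)))

  ∑-allFin : ∀ n f → ∑ (allFin n) (f ∘ toℕ) ≡ ∑ (upTo n) f
  ∑-allFin zero    f = trans ∑-[] (sym ∑-[])
  ∑-allFin (suc n) f = begin
    ∑ (allFin (suc n)) (f ∘ toℕ)          ≡⟨ ∑-allFin-suc n (f ∘ toℕ) ⟩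
    f 0 ⊕ ∑ (allFin n) ((f ∘ suc) ∘ toℕ)  ≡⟨ cong (f 0 ⊕_) (∑-allFin n (f ∘ suc)) ⟩
    f 0 ⊕ ∑ (upTo n) (f ∘ suc)            ≡⟨ ∑-upTo-suc n f ⟨
    ∑ (upTo (suc n)) f                    ∎

  ∑-upTo-+ : ∀ m n f → ∑ (upTo (m ℕ.+ n)) f ≡ ∑ (upTo m) f ⊕ ∑ (upTo n) (λ i → f (m ℕ.+ i))
  ∑-upTo-+ zero    n f = sym (trans (+-congʳ ∑-[]) (+-identityˡ _))
  ∑-upTo-+ (suc m) n f = begin
    ∑ (upTo (suc (m ℕ.+ n))) f
      ≡⟨ ∑-upTo-suc (m ℕ.+ n) f ⟩
    f 0 ⊕ ∑ (upTo (m ℕ.+ n)) (f ∘ suc)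
      ≡⟨ cong (f 0 ⊕_) (∑-upTo-+ m n (f ∘ suc)) ⟩
    f 0 ⊕ (∑ (upTo m) (f ∘ suc) ⊕ ∑ (upTo n) (λ i → f (suc m ℕ.+ i)))
      ≡⟨ +-assoc _ _ _ ⟨
    (f 0 ⊕ ∑ (upTo m) (f ∘ suc)) ⊕ ∑ (upTo n) (λ i → f (suc m ℕ.+ i))
      ≡⟨ +-congʳ (∑-upTo-suc m f) ⟨
    ∑ (upTo (suc m)) f ⊕ ∑ (upTo n) (λ i → f (suc m ℕ.+ i)) ∎

  ∑-upTo-cong : ∀ n {f g : ℕ → C} → (∀ i → i ℕ.< n → f i ≡ g i) → ∑ (upTo n) f ≡ ∑ (upTo n) g
  ∑-upTo-cong n {f} {g} eq = begin
    ∑ (upTo n) f            ≡⟨ ∑-allFin n f ⟨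
    ∑ (allFin n) (f ∘ toℕ)  ≡⟨ ∑-cong (allFin n) (λ i → eq (toℕ i) (Fin.toℕ<n i)) ⟩
    ∑ (allFin n) (g ∘ toℕ)  ≡⟨ ∑-allFin n g ⟩
    ∑ (upTo n) g            ∎

  ∑-upTo-extend : ∀ {m n} f → m ℕ.≤ n → (∀ i → m ℕ.≤ i → i ℕ.< n → f i ≡ 𝟎) →
                  ∑ (upTo m) f ≡ ∑ (upTo n) f
  ∑-upTo-extend {m} {n} f m≤n f≡0 = begin
    ∑ (upTo m) f
      ≡⟨ +-identityʳ _ ⟨
    ∑ (upTo m) f ⊕ 𝟎
      ≡⟨ cong (∑ (upTo m) f ⊕_) (∑-zero (upTo k)) ⟨
    ∑ (upTo m) f ⊕ ∑ (upTo k) (λ _ → 𝟎)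
      ≡⟨ cong (∑ (upTo m) f ⊕_) (∑-upTo-cong k λ i i<k → f≡0 (m ℕ.+ i) (ℕ.m≤m+n m i)
           (subst (m ℕ.+ i ℕ.<_) m+k≡n (ℕ.+-monoʳ-< m i<k))) ⟨
    ∑ (upTo m) f ⊕ ∑ (upTo k) (λ i → f (m ℕ.+ i))
      ≡⟨ ∑-upTo-+ m k f ⟨
    ∑ (upTo (m ℕ.+ k)) f
      ≡⟨ cong (λ l → ∑ (upTo l) f) m+k≡n ⟩
    ∑ (upTo n) f ∎
    where
    k = n ℕ.∸ m
    m+k≡n : m ℕ.+ k ≡ n
    m+k≡n = ℕ.m+[n∸m]≡n m≤n

  ∑-upTo-* : ∀ m n (f : ℕ → C) → ∑ (upTo (m ℕ.* n)) f ≡ ∑ (upTo m) (λ i → ∑ (upTo n) (λ j → f (i ℕ.* n ℕ.+ j)))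
  ∑-upTo-* zero    n f = trans ∑-[] (sym ∑-[])
  ∑-upTo-* (suc m) n f = begin
    ∑ (upTo (n ℕ.+ m ℕ.* n)) f
      ≡⟨ ∑-upTo-+ n (m ℕ.* n) f ⟩
    ∑ (upTo n) f ⊕ ∑ (upTo (m ℕ.* n)) (λ k → f (n ℕ.+ k))
      ≡⟨ cong (∑ (upTo n) f ⊕_) (∑-upTo-* m n (λ k → f (n ℕ.+ k))) ⟩
    ∑ (upTo n) f ⊕ ∑ (upTo m) (λ i → ∑ (upTo n) (λ j → f (n ℕ.+ (i ℕ.* n ℕ.+ j))))
      ≡⟨ cong (∑ (upTo n) f ⊕_) (∑-cong (upTo m) λ i → ∑-cong (upTo n) λ j →
           cong f (sym (ℕ.+-assoc n (i ℕ.* n) j))) ⟩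
    ∑ (upTo n) f ⊕ ∑ (upTo m) (λ i → ∑ (upTo n) (λ j → f (suc i ℕ.* n ℕ.+ j)))
      ≡⟨ ∑-upTo-suc m _ ⟨
    ∑ (upTo (suc m)) (λ i → ∑ (upTo n) (λ j → f (i ℕ.* n ℕ.+ j))) ∎

  ⟦⟧-cong : ∀ {P Q : Set} (P? : Dec P) (Q? : Dec Q) → (P → Q) → (Q → P) → ⟦ P? ⟧ ≡ ⟦ Q? ⟧
  ⟦⟧-cong (yes p) (yes q) f g = refl
  ⟦⟧-cong (yes p) (no ¬q) f g = contradiction (f p) ¬q
  ⟦⟧-cong (no ¬p) (yes q) f g = contradiction (g q) ¬p
  ⟦⟧-cong (no ¬p) (no ¬q) f g = refl

  ⟦⟧-true : ∀ {P : Set} (P? : Dec P) → P → ⟦ P? ⟧ ≡ 𝟏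
  ⟦⟧-true (yes p) _ = refl
  ⟦⟧-true (no ¬p) p = contradiction p ¬p

  ⟦⟧-false : ∀ {P : Set} (P? : Dec P) → ¬ P → ⟦ P? ⟧ ≡ 𝟎
  ⟦⟧-false (yes p) ¬p = contradiction p ¬p
  ⟦⟧-false (no ¬p) _  = refl

  ⟦⟧-×-dec : ∀ {P Q : Set} (P? : Dec P) (Q? : Dec Q) → ⟦ P? ×-dec Q? ⟧ ≡ ⟦ P? ⟧ ⊗ ⟦ Q? ⟧
  ⟦⟧-×-dec P? Q? with does P? | does Q?
  ... | true  | true  = sym (*-identityˡ _)
  ... | true  | false = sym (*-identityˡ _)
  ... | false | _     = sym (zeroˡ _)

  ⟦⟧-⊗-cong : ∀ {P : Set} (P? : Dec P) {a b} → (P → a ≡ b) → ⟦ P? ⟧ ⊗ a ≡ ⟦ P? ⟧ ⊗ b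
  ⟦⟧-⊗-cong (yes p) eq = cong (𝟏 ⊗_) (eq p)
  ⟦⟧-⊗-cong (no _)  eq = trans (zeroˡ _) (sym (zeroˡ _))

  ∑-upTo-≥ : ∀ m n (f : ℕ → C) → ∑ (upTo n) (λ i → ⟦ m ℕ.≤? i ⟧ ⊗ f i) ≡ ∑ (upTo (n ℕ.∸ m)) (λ i → f (m ℕ.+ i))
  ∑-upTo-≥ zero    n       f = ∑-cong (upTo n) λ i → *-identityˡ (f i)
  ∑-upTo-≥ (suc m) zero    f = trans ∑-[] (sym ∑-[])
  ∑-upTo-≥ (suc m) (suc n) f = begin
    ∑ (upTo (suc n)) (λ i → ⟦ suc m ℕ.≤? i ⟧ ⊗ f i)
      ≡⟨ ∑-upTo-suc n _ ⟩
    (𝟎 ⊗ f 0) ⊕ ∑ (upTo n) (λ i → ⟦ suc m ℕ.≤? suc i ⟧ ⊗ f (suc i))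
      ≡⟨ trans (+-congʳ (zeroˡ (f 0))) (+-identityˡ _) ⟩
    ∑ (upTo n) (λ i → ⟦ suc m ℕ.≤? suc i ⟧ ⊗ f (suc i))
      ≡⟨ ∑-cong (upTo n) (λ i → *-congʳ (⟦⟧-cong (suc m ℕ.≤? suc i) (m ℕ.≤? i) ℕ.s≤s⁻¹ ℕ.s≤s)) ⟩
    ∑ (upTo n) (λ i → ⟦ m ℕ.≤? i ⟧ ⊗ f (suc i))
      ≡⟨ ∑-upTo-≥ m n (f ∘ suc) ⟩
    ∑ (upTo (n ℕ.∸ m)) (λ i → f (suc (m ℕ.+ i))) ∎

  -- Over ℕ, ℤ and ℚ this says that every y has exactly one representative in the list up to `_~_`.
  -- As a sum of brackets it can be inserted into a calculation, or collapsed, without handling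
  -- membership and uniqueness.
  Enumerates : {_~_ : A → A → Set} → List A → (∀ x y → Dec (x ~ y)) → Set
  Enumerates xs _~?_ = ∀ y → ∑ xs (λ x → ⟦ x ~? y ⟧) ≡ 𝟏

  module _ {_~_ : A → A → Set} {xs : List A} (_~?_ : ∀ x y → Dec (x ~ y))
    (enum : Enumerates xs _~?_) where

    ∑-select : ∀ {f : A → C} → (∀ x y → x ~ y → f x ≡ f y) →
               ∀ y → ∑ xs (λ x → ⟦ x ~? y ⟧ ⊗ f x) ≡ f y
    ∑-select {f} f-cong y = begin
      ∑ xs (λ x → ⟦ x ~? y ⟧ ⊗ f x)  ≡⟨ ∑-cong xs (λ x → ⟦⟧-⊗-cong (x ~? y) (f-cong x y)) ⟩
      ∑ xs (λ x → ⟦ x ~? y ⟧ ⊗ f y)  ≡⟨ ∑-⊗ xs _ (f y) ⟨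
      ∑ xs (λ x → ⟦ x ~? y ⟧) ⊗ f y  ≡⟨ cong (_⊗ f y) (enum y) ⟩
      𝟏 ⊗ f y                        ≡⟨ *-identityˡ _ ⟩
      f y                            ∎

    -- A change of variables in which h inverts g only up to `_~_`. Writing f (g x) as a sum over y
    -- with y ~ g x and exchanging the sums leaves, for each y, the x with x ~ h y, of which there
    -- is one.
    ∑-reindex : ∀ {f : A → C} → (∀ x y → x ~ y → f x ≡ f y) →
                (g h : A → A) → (∀ x y → y ~ g x → x ~ h y) → (∀ x y → x ~ h y → y ~ g x) →
                ∑ xs (f ∘ g) ≡ ∑ xs f
    ∑-reindex {f} f-cong g h to from = begin
      ∑ xs (f ∘ g)
        ≡⟨ ∑-cong xs (λ x → ∑-select f-cong (g x)) ⟨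
      ∑ xs (λ x → ∑ xs (λ y → ⟦ y ~? g x ⟧ ⊗ f y))
        ≡⟨ ∑-swap xs xs _ ⟩
      ∑ xs (λ y → ∑ xs (λ x → ⟦ y ~? g x ⟧ ⊗ f y))
        ≡⟨ ∑-cong xs (λ y → ∑-cong xs λ x → cong (_⊗ f y) (⟦⟧-cong (y ~? g x) (x ~? h y) (to x y) (from x y))) ⟩
      ∑ xs (λ y → ∑ xs (λ x → ⟦ x ~? h y ⟧ ⊗ f y))
        ≡⟨ ∑-cong xs (λ y → ∑-⊗ xs _ (f y)) ⟨
      ∑ xs (λ y → ∑ xs (λ x → ⟦ x ~? h y ⟧) ⊗ f y)
        ≡⟨ ∑-cong xs (λ y → trans (cong (_⊗ f y) (enum (h y))) (*-identityˡ _)) ⟩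
      ∑ xs f ∎

  allFin-enumerates : ∀ n → Enumerates (allFin n) Fin._≟_
  allFin-enumerates (suc n) zero = begin
    ∑ (allFin (suc n)) (λ i → ⟦ i Fin.≟ zero ⟧)  ≡⟨ ∑-allFin-suc n _ ⟩
    𝟏 ⊕ ∑ (allFin n) (λ i → 𝟎)                   ≡⟨ cong (𝟏 ⊕_) (∑-zero (allFin n)) ⟩
    𝟏 ⊕ 𝟎                                        ≡⟨ +-identityʳ 𝟏 ⟩
    𝟏                                            ∎
  allFin-enumerates (suc n) (suc j) = begin
    ∑ (allFin (suc n)) (λ i → ⟦ i Fin.≟ suc j ⟧)
      ≡⟨ ∑-allFin-suc n _ ⟩
    𝟎 ⊕ ∑ (allFin n) (λ i → ⟦ suc i Fin.≟ suc j ⟧)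
      ≡⟨ +-identityˡ _ ⟩
    ∑ (allFin n) (λ i → ⟦ suc i Fin.≟ suc j ⟧)
      ≡⟨ ∑-cong (allFin n) (λ i → ⟦⟧-cong (suc i Fin.≟ suc j) (i Fin.≟ j) Fin.suc-injective (cong suc)) ⟩
    ∑ (allFin n) (λ i → ⟦ i Fin.≟ j ⟧)
      ≡⟨ allFin-enumerates n j ⟩
    𝟏 ∎

  private
    ∑-⟦⟧-product : ∀ {_~ᴬ_ : A → A → Set} {_~ᴮ_ : B → B → Set}
                   {xs : List A} {ys : List B} (_~?_ : ∀ x y → Dec (x ~ᴬ y)) (_≃?_ : ∀ x y → Dec (x ~ᴮ y)) →
                   Enumerates xs _~?_ → Enumerates ys _≃?_ →
                   ∀ a b → ∑ xs (λ x → ∑ ys (λ y → ⟦ x ~? a ⟧ ⊗ ⟦ y ≃? b ⟧)) ≡ 𝟏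
    ∑-⟦⟧-product {xs = xs} {ys} _~?_ _≃?_ ex ey a b = begin
      ∑ xs (λ x → ∑ ys (λ y → ⟦ x ~? a ⟧ ⊗ ⟦ y ≃? b ⟧)) ≡⟨ ∑-cong xs (λ x → ⊗-∑ _ ys _) ⟨
      ∑ xs (λ x → ⟦ x ~? a ⟧ ⊗ ∑ ys (λ y → ⟦ y ≃? b ⟧))
        ≡⟨ ∑-cong xs (λ x → trans (*-congˡ (ey b)) (*-identityʳ _)) ⟩
      ∑ xs (λ x → ⟦ x ~? a ⟧)                           ≡⟨ ex a ⟩
      𝟏                                                 ∎

  tuples-enumerate : ∀ r {xs : List A} (_≟_ : DecidableEquality A) →
                     Enumerates xs _≟_ → Enumerates (tuples r xs) (Vec.≡-dec {n = r} _≟_)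
  tuples-enumerate zero         _≟_ enum []      = ∑-singleton
  tuples-enumerate (suc r) {xs} _≟_ enum (y ∷ w) = begin
    ∑ (tuples (suc r) xs) (λ v → ⟦ Vec.≡-dec _≟_ v (y ∷ w) ⟧)
      ≡⟨ ∑-cartesianProductWith _∷_ xs (tuples r xs) _ ⟩
    ∑ xs (λ x → ∑ (tuples r xs) λ v → ⟦ Vec.≡-dec _≟_ (x ∷ v) (y ∷ w) ⟧)
      ≡⟨ ∑-cong xs (λ x → ∑-cong (tuples r xs) λ v → ⟦⟧-×-dec (x ≟ y) (Vec.≡-dec _≟_ v w)) ⟩
    ∑ xs (λ x → ∑ (tuples r xs) λ v → ⟦ x ≟ y ⟧ ⊗ ⟦ Vec.≡-dec _≟_ v w ⟧)
      ≡⟨ ∑-⟦⟧-product _≟_ (Vec.≡-dec _≟_) enum (tuples-enumerate r _≟_ enum) y w ⟩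
    𝟏 ∎

  perms-enumerate : ∀ n → Enumerates (perms n) _≈?_
  perms-enumerate zero    τ = ∑-singleton
  perms-enumerate (suc n) τ = begin
    ∑ (perms (suc n)) (λ σ → ⟦ σ ≈? τ ⟧)
      ≡⟨ ∑-cartesianProductWith (insert zero) (allFin (suc n)) (perms n) _ ⟩
    ∑ (allFin (suc n)) (λ j → ∑ (perms n) λ σ → ⟦ insert zero j σ ≈? τ ⟧)
      ≡⟨ ∑-cong (allFin (suc n)) (λ j → ∑-cong (perms n) λ σ → trans
           (⟦⟧-cong (insert zero j σ ≈? τ) ((j Fin.≟ τ ⟨$⟩ʳ zero) ×-dec (σ ≈? remove zero τ))
             (insert-≈⁻ {σ = σ} {τ}) (λ (p , q) → insert-≈⁺ {σ = σ} {τ} p q))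
           (⟦⟧-×-dec (j Fin.≟ τ ⟨$⟩ʳ zero) (σ ≈? remove zero τ))) ⟩
    ∑ (allFin (suc n)) (λ j → ∑ (perms n) λ σ → ⟦ j Fin.≟ τ ⟨$⟩ʳ zero ⟧ ⊗ ⟦ σ ≈? remove zero τ ⟧)
      ≡⟨ ∑-⟦⟧-product Fin._≟_ _≈?_ (allFin-enumerates (suc n)) (perms-enumerate n) (τ ⟨$⟩ʳ zero) (remove zero τ) ⟩
    𝟏 ∎

-- Words and permutations are counted in ℕ, finite differences need the signs of ℤ, and
-- probabilities live in ℚ.
module Σℕ = BigSum ℕ.+-*-isCommutativeSemiring
module Σℤ = BigSum ℤ.+-*-isCommutativeSemiring
module Σℚ = BigSum (IsCommutativeRing.isCommutativeSemiring ℚ.+-*-isCommutativeRing)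

-- Lattice points, words and permutations

module _ where

  open import Data.Nat.Base using (_+_; _*_; _<_)
  open Σℕ

  -- The number of y ∈ ℕⁿ with y₁ + ⋯ + yₙ < N.
  simplex : ℕ → ℕ → ℕ
  simplex zero    zero    = 0
  simplex zero    (suc N) = 1
  simplex (suc n) zero    = 0
  simplex (suc n) (suc N) = simplex n (suc N) + simplex (suc n) N

  simplex-zero : ∀ n → simplex n 0 ≡ 0
  simplex-zero zero    = refl
  simplex-zero (suc n) = refl

  simplex-suc : ∀ n N → simplex (suc n) N ≡ ∑ (upTo N) (λ y → simplex n (N ∸ y))
  simplex-suc n zero    = sym ∑-[]
  simplex-suc n (suc N) = trans (cong (simplex n (suc N) +_) (simplex-suc n N)) (sym (∑-upTo-suc N _))

  -- One coordinate is summed out. Terms with y ≥ N ∸ j are zero, so any range that is long enough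
  -- will do; the alphabets below supply such ranges without matching N ∸ j exactly.
  ∑-simplex : ∀ n N j M → N ≤ j + M →
              ∑ (upTo M) (λ y → simplex n (N ∸ (j + y))) ≡ simplex (suc n) (N ∸ j)
  ∑-simplex n N j M N≤j+M = begin
    ∑ (upTo M) (λ y → simplex n (N ∸ (j + y)))
      ≡⟨ ∑-cong (upTo M) (λ y → cong (simplex n) (sym (ℕ.∸-+-assoc N j y))) ⟩
    ∑ (upTo M) (λ y → simplex n (N ∸ j ∸ y))
      ≡⟨ ∑-upTo-extend _ (ℕ.m≤n+o⇒m∸n≤o N j N≤j+M) (λ y N∸j≤y _ →
           trans (cong (simplex n) (ℕ.m≤n⇒m∸n≡0 N∸j≤y)) (simplex-zero n)) ⟨
    ∑ (upTo (N ∸ j)) (λ y → simplex n (N ∸ j ∸ y))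
      ≡⟨ simplex-suc n (N ∸ j) ⟨
    simplex (suc n) (N ∸ j) ∎
    where open ≡-Reasoning

  simplex-C : ∀ n N → simplex n (suc N) ≡ (n + N) C n
  simplex-C zero    N       = refl
  simplex-C (suc n) zero    = begin
    simplex n 1 + 0        ≡⟨ ℕ.+-identityʳ _ ⟩
    simplex n 1            ≡⟨ simplex-C n 0 ⟩
    (n + 0) C n            ≡⟨ cong (_C n) (ℕ.+-identityʳ n) ⟩
    n C n                  ≡⟨ nCn≡1 n ⟩
    1                      ≡⟨ nCn≡1 (suc n) ⟨
    suc n C suc n          ≡⟨ cong (_C suc n) (ℕ.+-identityʳ (suc n)) ⟨
    (suc n + 0) C suc n    ∎
    where open ≡-Reasoning
  simplex-C (suc n) (suc N) = begin
    simplex n (suc (suc N)) + simplex (suc n) (suc N)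
      ≡⟨ cong₂ _+_ (simplex-C n (suc N)) (simplex-C (suc n) N) ⟩
    (n + suc N) C n + suc (n + N) C suc n
      ≡⟨ cong (λ k → (n + suc N) C n + k C suc n) (ℕ.+-suc n N) ⟨
    (n + suc N) C n + (n + suc N) C suc n              ≡⟨ nCk+nC[k+1]≡[n+1]C[k+1] (n + suc N) n ⟩
    suc (n + suc N) C suc n                            ∎
    where open ≡-Reasoning

  -- The binomial vanishes once its top is below its bottom, which is exactly where `c ∸ j` is cut
  -- off at zero. Both the binomials of Q_b and those of P_b have this shape.
  simplex-∸-C : ∀ {m j} c → j ≤ m → (m ∸ j + c) C suc m ≡ simplex (suc m) (c ∸ j)
  simplex-∸-C {m} {j} c j≤m with c ℕ.≤? j
  ... | yes c≤j = trans
    (k>n⇒nCk≡0 (s≤s (ℕ.≤-trans (ℕ.+-monoʳ-≤ (m ∸ j) c≤j) (ℕ.≤-reflexive (ℕ.m∸n+n≡m j≤m)))))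
    (cong (simplex (suc m)) (sym (ℕ.m≤n⇒m∸n≡0 c≤j)))
  ... | no c≰j with k , refl ← ℕ.m≤n⇒∃[o]m+o≡n (ℕ.≰⇒> c≰j) = begin
    (m ∸ j + suc (j + k)) C suc m          ≡⟨ cong (_C suc m) (solve-∀′ (m ∸ j) j k) ⟩
    (suc (m ∸ j + j) + k) C suc m          ≡⟨ cong (λ l → (suc l + k) C suc m) (ℕ.m∸n+n≡m j≤m) ⟩
    (suc m + k) C suc m                    ≡⟨ simplex-C (suc m) k ⟨
    simplex (suc m) (suc k)                ≡⟨ cong (simplex (suc m)) (ℕ.m+n∸m≡n j (suc k)) ⟨
    simplex (suc m) (j + suc k ∸ j)        ≡⟨ cong (λ l → simplex (suc m) (l ∸ j)) (ℕ.+-suc j k) ⟩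
    simplex (suc m) (suc (j + k) ∸ j)      ∎
    where
    open ≡-Reasoning
    solve-∀′ : ∀ a b c → a + suc (b + c) ≡ suc (a + b) + c
    solve-∀′ = solve-∀

  digitSum : ∀ {b k} → Vec (Fin b) k → ℕ
  digitSum x = Vec.sum (Vec.map toℕ x)

  -- Writing y = z b + x digit by digit, Σ y < a b - j becomes Σ z < a - ⌊(j + Σ x) / b⌋.
  ∑-digits : ∀ k a b .{{_ : NonZero b}} j →
             ∑ (tuples k (allFin b)) (λ x → simplex k (a ∸ (j + digitSum x) ℕ./ b)) ≡ simplex k (a * b ∸ j)
  ∑-digits zero a b j = begin
    ∑ ([] ∷ []) (λ x → simplex 0 (a ∸ (j + digitSum x) ℕ./ b)) ≡⟨ ∑-singleton ⟩
    simplex 0 (a ∸ (j + 0) ℕ./ b)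
      ≡⟨ cong (λ l → simplex 0 (a ∸ l ℕ./ b)) (ℕ.+-identityʳ j) ⟩
    simplex 0 (a ∸ j ℕ./ b)                                    ≡⟨ lemma ⟩
    simplex 0 (a * b ∸ j)                                      ∎
    where
    open ≡-Reasoning
    positive : ∀ {N} → 0 < N → simplex 0 N ≡ 1
    positive (s≤s _) = refl
    lemma : simplex 0 (a ∸ j ℕ./ b) ≡ simplex 0 (a * b ∸ j)
    lemma with a ℕ.≤? j ℕ./ b
    ... | yes a≤ = cong (simplex 0) (trans (ℕ.m≤n⇒m∸n≡0 a≤) (sym (ℕ.m≤n⇒m∸n≡0
      (ℕ.≤-trans (ℕ.*-monoˡ-≤ b a≤) (DivMod.m/n*n≤m j b)))))
    ... | no a≰ = trans (positive (ℕ.m<n⇒0<n∸m (ℕ.≰⇒> a≰))) (sym (positive (ℕ.m<n⇒0<n∸m (ℕ.≰⇒> λ ab≤j →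
      a≰ (subst (_≤ j ℕ./ b) (DivMod.m*n/n≡m a b) (DivMod./-monoˡ-≤ b ab≤j))))))
  ∑-digits (suc k) a b j = begin
    ∑ (tuples (suc k) (allFin b)) (λ x → simplex (suc k) (a ∸ (j + digitSum x) ℕ./ b))
      ≡⟨ ∑-cartesianProductWith _∷_ (allFin b) (tuples k (allFin b)) _ ⟩
    ∑ (allFin b) (λ x → ∑ T λ v → simplex (suc k) (a ∸ (j + (toℕ x + digitSum v)) ℕ./ b))
      ≡⟨ ∑-cong (allFin b) (λ x → ∑-cong T λ v → sym (∑-simplex k a ((j + (toℕ x + digitSum v)) ℕ./ b) a (ℕ.m≤n+m a _))) ⟩
    ∑ (allFin b) (λ x → ∑ T λ v → ∑ (upTo a) λ z → simplex k (a ∸ ((j + (toℕ x + digitSum v)) ℕ./ b + z)))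
      ≡⟨ ∑-cong (allFin b) (λ x → ∑-swap T (upTo a) _) ⟩
    ∑ (allFin b) (λ x → ∑ (upTo a) λ z → ∑ T λ v → simplex k (a ∸ ((j + (toℕ x + digitSum v)) ℕ./ b + z)))
      -- Adding z after the division is adding z b before it, so digit and quotient merge into y = z
      -- b + x. This y moves into the starting carry, hence the induction needs an arbitrary j.
      ≡⟨ ∑-cong (allFin b) (λ x → ∑-cong (upTo a) λ z → ∑-cong T λ v →
           cong (λ l → simplex k (a ∸ l)) (absorb (toℕ x) (digitSum v) z)) ⟩
    ∑ (allFin b) (λ x → ∑ (upTo a) λ z → ∑ T λ v → simplex k (a ∸ ((j + (z * b + toℕ x)) + digitSum v) ℕ./ b))
      ≡⟨ ∑-cong (allFin b) (λ x → ∑-cong (upTo a) λ z → ∑-digits k a b (j + (z * b + toℕ x))) ⟩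
    ∑ (allFin b) (λ x → ∑ (upTo a) λ z → simplex k (a * b ∸ (j + (z * b + toℕ x))))
      ≡⟨ ∑-swap (allFin b) (upTo a) _ ⟩
    ∑ (upTo a) (λ z → ∑ (allFin b) λ x → simplex k (a * b ∸ (j + (z * b + toℕ x))))
      ≡⟨ ∑-cong (upTo a) (λ z → ∑-allFin b λ x → simplex k (a * b ∸ (j + (z * b + x)))) ⟩
    ∑ (upTo a) (λ z → ∑ (upTo b) λ x → simplex k (a * b ∸ (j + (z * b + x))))
      ≡⟨ ∑-upTo-* a b (λ y → simplex k (a * b ∸ (j + y))) ⟨
    ∑ (upTo (a * b)) (λ y → simplex k (a * b ∸ (j + y)))
      ≡⟨ ∑-simplex k (a * b) j (a * b) (ℕ.m≤n+m (a * b) j) ⟩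
    simplex (suc k) (a * b ∸ j) ∎
    where
    open ≡-Reasoning
    T = tuples k (allFin b)
    rearrange : ∀ j x s w → j + (x + s) + w ≡ (j + (w + x)) + s
    rearrange = solve-∀
    absorb : ∀ x s z → (j + (x + s)) ℕ./ b + z ≡ ((j + (z * b + x)) + s) ℕ./ b
    absorb x s z = begin
      (j + (x + s)) ℕ./ b + z                ≡⟨ cong ((j + (x + s)) ℕ./ b +_) (DivMod.m*n/n≡m z b) ⟨
      (j + (x + s)) ℕ./ b + (z * b) ℕ./ b    ≡⟨ DivMod.+-distrib-/-∣ʳ (j + (x + s)) (n∣m*n z) ⟨
      (j + (x + s) + z * b) ℕ./ b            ≡⟨ cong (ℕ._/ b) (rearrange j x s (z * b)) ⟩
      ((j + (z * b + x)) + s) ℕ./ b          ∎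

  -- p * N + x with x < N encodes the pair (p, x), ordered lexicographically.

  lex-<⁺ : ∀ {p p′ x N x′} → p < p′ → x < N → p * N + x < p′ * N + x′
  lex-<⁺ {p} {p′} {x} {N} {x′} p<p′ x<N = begin-strict
    p * N + x    <⟨ ℕ.+-monoʳ-< (p * N) x<N ⟩
    p * N + N    ≡⟨ ℕ.+-comm (p * N) N ⟩
    suc p * N    ≤⟨ ℕ.*-monoˡ-≤ N p<p′ ⟩
    p′ * N       ≤⟨ ℕ.m≤m+n (p′ * N) x′ ⟩
    p′ * N + x′  ∎
    where open ℕ.≤-Reasoning

  lex-<⁻ : ∀ {x′ N p x p′} → x′ < N → p * N + x < p′ * N + x′ → p < p′ ⊎ (p ≡ p′ × x < x′)
  lex-<⁻ {x′} {N} {p} {x} {p′} x′<N lt with ℕ.<-cmp p p′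
  ... | tri< p<p′ _ _ = inj₁ p<p′
  ... | tri≈ _ refl _ = inj₂ (refl , ℕ.+-cancelˡ-< (p * N) x x′ lt)
  ... | tri> _ _ p>p′ = contradiction lt (ℕ.<-asym (lex-<⁺ p>p′ x′<N))

  lex-map : ∀ {x′ N y M x y′ p p′} → x′ < N → y < M → (x < x′ → y < y′) →
            p * N + x < p′ * N + x′ → p * M + y < p′ * M + y′
  lex-map {p = p} {p′} x′<N y<M f lt with lex-<⁻ {p = p} {p′ = p′} x′<N lt
  ... | inj₁ p<p′          = lex-<⁺ p<p′ y<M
  ... | inj₂ (refl , x<x′) = ℕ.+-monoʳ-< _ (f x<x′)

  -- Increasing words with prescribed descents

  StrictlyMonotone : (Fin n → ℕ) → Set
  StrictlyMonotone c = ∀ {i j} → i Fin.< j → c i < c j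

  -- Comparing neighbours only makes the condition decidable and lets words be counted letter by
  -- letter; `StrictlyMonotone` is the form suited to sorting.
  Increasing : (Fin n → ℕ) → Set
  Increasing {zero}        c = ⊤
  Increasing {suc zero}    c = ⊤
  Increasing {suc (suc n)} c = c zero < c (suc zero) × Increasing (c ∘ suc)

  increasing? : (c : Fin n → ℕ) → Dec (Increasing c)
  increasing? {zero}        c = yes tt
  increasing? {suc zero}    c = yes tt
  increasing? {suc (suc n)} c = (c zero ℕ.<? c (suc zero)) ×-dec increasing? (c ∘ suc)

  increasing⇒monotone : (c : Fin n → ℕ) → Increasing c → StrictlyMonotone c
  increasing⇒monotone {suc zero}    c _          {zero}  {zero}        ()
  increasing⇒monotone {suc (suc n)} c (c₀<c₁ , _)   {zero}  {suc zero}    _ = c₀<c₁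
  increasing⇒monotone {suc (suc n)} c (c₀<c₁ , inc) {zero}  {suc (suc j)} _ =
    ℕ.<-trans c₀<c₁ (increasing⇒monotone (c ∘ suc) inc {zero} {suc j} (s≤s z≤n))
  increasing⇒monotone {suc (suc n)} c (_ , inc)  {suc i} {suc j} (s≤s i<j) =
    increasing⇒monotone (c ∘ suc) inc i<j

  monotone⇒increasing : (c : Fin n → ℕ) → StrictlyMonotone c → Increasing c
  monotone⇒increasing {zero}        c mono = tt
  monotone⇒increasing {suc zero}    c mono = tt
  monotone⇒increasing {suc (suc n)} c mono =
    mono (s≤s z≤n) , monotone⇒increasing (c ∘ suc) (λ i<j → mono (s≤s i<j))

  increasing-map : (c c′ : Fin n → ℕ) → (∀ i j → c i < c j → c′ i < c′ j) →
                   Increasing c → Increasing c′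
  increasing-map c c′ f inc =
    monotone⇒increasing c′ λ i<j → f _ _ (increasing⇒monotone c inc i<j)

  -- Defined for any sequence because the counting induction drops the first entry, and the tail of
  -- a permutation is no permutation.
  descents : (Fin (suc n) → ℕ) → Subset n
  descents x = tabulate λ i → does (x (suc i) ℕ.<? x (inject₁ i))

  ∣∷∣ : ∀ b (p : Subset n) → ∣ b ∷ p ∣ ≡ (if b then 1 else 0) + ∣ p ∣
  ∣∷∣ true  p = refl
  ∣∷∣ false p = refl

  -- An alphabet of M letters with a numbering κ that sums cannot tell from 0, ..., M - 1. It is
  -- used both for single letters and for pairs of letters.
  module _ {xs : List A} {κ : A → ℕ} (M : ℕ) (κ<M : ∀ u → κ u < M)
    (∑-κ : ∀ f → ∑ xs (f ∘ κ) ≡ ∑ (upTo M) f) (N : ℕ) where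

    private
      lex : Vec A n → (Fin n → ℕ) → Fin n → ℕ
      lex v x i = κ (lookup v i) * N + x i

      +⟦⟧-true : ∀ {x x′} p → x′ < x → p + ⟦ x′ ℕ.<? x ⟧ ≡ suc p
      +⟦⟧-true p x′<x = trans (cong (p +_) (⟦⟧-true (_ ℕ.<? _) x′<x)) (ℕ.+-comm p 1)

      +⟦⟧-false : ∀ {x x′} p → ¬ x′ < x → p + ⟦ x′ ℕ.<? x ⟧ ≡ p
      +⟦⟧-false p x′≮x = trans (cong (p +_) (⟦⟧-false (_ ℕ.<? _) x′≮x)) (ℕ.+-identityʳ p)

      -- With `lex-≤-<` this turns a lexicographic inequality between codes with x ≠ x′ into a lower
      -- bound for the next letter: it may repeat p, unless x′ < x forces it up by one.
      lex-<-≤ : ∀ {p x p′ x′} → p * N + x < p′ * N + x′ → x′ < N → p + ⟦ x′ ℕ.<? x ⟧ ≤ p′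
      lex-<-≤ {p} {x} {p′} {x′} lt x′<N with x′ ℕ.<? x | lex-<⁻ {p = p} x′<N lt
      ... | yes x′<x | inj₁ p<p′       = subst (_≤ p′) (sym (+⟦⟧-true p x′<x)) p<p′
      ... | yes x′<x | inj₂ (_ , x<x′) = contradiction x<x′ (ℕ.<-asym x′<x)
      ... | no  x′≮x | inj₁ p<p′       = subst (_≤ p′) (sym (+⟦⟧-false p x′≮x)) (ℕ.<⇒≤ p<p′)
      ... | no  x′≮x | inj₂ (p≡p′ , _) = ℕ.≤-reflexive (trans (+⟦⟧-false p x′≮x) p≡p′)

      lex-≤-< : ∀ {p x′ x p′} → p + ⟦ x′ ℕ.<? x ⟧ ≤ p′ → x ≢ x′ → x < N → p * N + x < p′ * N + x′
      lex-≤-< {p} {x′} {x} {p′} le x≢x′ x<N with x′ ℕ.<? x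
      ... | yes x′<x = lex-<⁺ (subst (_≤ p′) (+⟦⟧-true p x′<x) le) x<N
      ... | no  x′≮x with ℕ.m≤n⇒m<n∨m≡n (subst (_≤ p′) (+⟦⟧-false p x′≮x) le)
      ...   | inj₁ p<p′ = lex-<⁺ p<p′ x<N
      ...   | inj₂ refl = ℕ.+-monoʳ-< (p * N) (ℕ.≤∧≢⇒< (ℕ.≮⇒≥ x′≮x) x≢x′)

    -- After the first letter u, each of the n steps exceeds its forced minimum (1 at a descent, 0
    -- elsewhere) by a free natural number. The last letter stays below M exactly if these excesses
    -- add up to less than M - κ u - ∣descents∣.
    ∑-increasing-∷ : (x : Fin (suc n) → ℕ) → (∀ {i j} → x i ≡ x j → i ≡ j) → (∀ i → x i < N) → ∀ u →
      ∑ (tuples n xs) (λ v → ⟦ increasing? (lex (u ∷ v) x) ⟧) ≡ simplex n (M ∸ κ u ∸ ∣ descents x ∣)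
    ∑-increasing-∷ {zero} x inj x<N u = trans ∑-singleton (positive (ℕ.m<n⇒0<n∸m (κ<M u)))
      where
      positive : ∀ {k} → 0 < k → 1 ≡ simplex 0 k
      positive (s≤s _) = refl
    ∑-increasing-∷ {suc n} x inj x<N u = begin
      ∑ (tuples (suc n) xs) (λ v → ⟦ increasing? (lex (u ∷ v) x) ⟧)
        ≡⟨ ∑-cartesianProductWith _∷_ xs (tuples n xs) _ ⟩
      ∑ xs (λ w → ∑ (tuples n xs) λ v → ⟦ increasing? (lex (u ∷ w ∷ v) x) ⟧)
        ≡⟨ ∑-cong xs (λ w → trans
             (∑-cong (tuples n xs) λ v → ⟦⟧-×-dec (first? w) (increasing? (lex (w ∷ v) x⁺)))
             (sym (⊗-∑ ⟦ first? w ⟧ (tuples n xs) _))) ⟩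
      ∑ xs (λ w → ⟦ first? w ⟧ * ∑ (tuples n xs) λ v → ⟦ increasing? (lex (w ∷ v) x⁺) ⟧)
        ≡⟨ ∑-cong xs (λ w → cong₂ _*_
             (⟦⟧-cong (first? w) (κ u + δ ℕ.≤? κ w)
               (λ lt → lex-<-≤ {p = κ u} lt (x<N _))
               (λ le → lex-≤-< {p = κ u} le x₀≢x₁ (x<N _)))
             (∑-increasing-∷ x⁺ (Fin.suc-injective ∘ inj) (x<N ∘ suc) w)) ⟩
      ∑ xs (λ w → ⟦ κ u + δ ℕ.≤? κ w ⟧ * simplex n (M ∸ κ w ∸ e))
        ≡⟨ ∑-κ (λ y → ⟦ κ u + δ ℕ.≤? y ⟧ * simplex n (M ∸ y ∸ e)) ⟩
      ∑ (upTo M) (λ y → ⟦ κ u + δ ℕ.≤? y ⟧ * simplex n (M ∸ y ∸ e))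
        ≡⟨ ∑-upTo-≥ (κ u + δ) M (λ y → simplex n (M ∸ y ∸ e)) ⟩
      ∑ (upTo (M ∸ (κ u + δ))) (λ y → simplex n (M ∸ (κ u + δ + y) ∸ e))
        ≡⟨ ∑-cong (upTo (M ∸ (κ u + δ))) (λ y → cong (simplex n) (∸-∸-comm M (κ u + δ + y) e)) ⟩
      ∑ (upTo (M ∸ (κ u + δ))) (λ y → simplex n (M ∸ e ∸ (κ u + δ + y)))
        ≡⟨ ∑-simplex n (M ∸ e) (κ u + δ) (M ∸ (κ u + δ))
             (ℕ.≤-trans (ℕ.m∸n≤m M e) (ℕ.m≤n+m∸n M (κ u + δ))) ⟩
      simplex (suc n) (M ∸ e ∸ (κ u + δ))
        ≡⟨ cong (simplex (suc n)) total ⟩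
      simplex (suc n) (M ∸ κ u ∸ ∣ descents x ∣) ∎
      where
      open ≡-Reasoning
      x⁺ = x ∘ suc
      δ = ⟦ x (suc zero) ℕ.<? x zero ⟧
      e = ∣ descents x⁺ ∣
      first? = λ w → κ u * N + x zero ℕ.<? κ w * N + x (suc zero)
      x₀≢x₁ : x zero ≢ x (suc zero)
      x₀≢x₁ eq with () ← inj eq
      ∸-∸-comm : ∀ a b c → a ∸ b ∸ c ≡ a ∸ c ∸ b
      ∸-∸-comm a b c = trans (ℕ.∸-+-assoc a b c) (trans (cong (a ∸_) (ℕ.+-comm b c)) (sym (ℕ.∸-+-assoc a c b)))
      total : M ∸ e ∸ (κ u + δ) ≡ M ∸ κ u ∸ ∣ descents x ∣
      total = begin
        M ∸ e ∸ (κ u + δ)        ≡⟨ ∸-∸-comm M e (κ u + δ) ⟩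
        M ∸ (κ u + δ) ∸ e        ≡⟨ cong (_∸ e) (ℕ.∸-+-assoc M (κ u) δ) ⟨
        M ∸ κ u ∸ δ ∸ e          ≡⟨ ℕ.∸-+-assoc (M ∸ κ u) δ e ⟩
        M ∸ κ u ∸ (δ + e)        ≡⟨ cong (M ∸ κ u ∸_) (∣∷∣ (does (x (suc zero) ℕ.<? x zero)) (descents x⁺)) ⟨
        M ∸ κ u ∸ ∣ descents x ∣ ∎

    ∑-increasing : (x : Fin (suc n) → ℕ) → (∀ {i j} → x i ≡ x j → i ≡ j) → (∀ i → x i < N) →
      ∑ (tuples (suc n) xs) (λ v → ⟦ increasing? (lex v x) ⟧) ≡ simplex (suc n) (M ∸ ∣ descents x ∣)
    ∑-increasing {n} x inj x<N = begin
      ∑ (tuples (suc n) xs) (λ v → ⟦ increasing? (lex v x) ⟧)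
        ≡⟨ ∑-cartesianProductWith _∷_ xs (tuples n xs) _ ⟩
      ∑ xs (λ w → ∑ (tuples n xs) λ v → ⟦ increasing? (lex (w ∷ v) x) ⟧)
        ≡⟨ ∑-cong xs (∑-increasing-∷ x inj x<N) ⟩
      ∑ xs (λ w → simplex n (M ∸ κ w ∸ e))
        ≡⟨ ∑-κ (λ y → simplex n (M ∸ y ∸ e)) ⟩
      ∑ (upTo M) (λ y → simplex n (M ∸ y ∸ e))
        ≡⟨ ∑-cong (upTo M) (λ y → cong (simplex n) (trans (ℕ.∸-+-assoc M y e) (cong (M ∸_) (ℕ.+-comm y e)))) ⟩
      ∑ (upTo M) (λ y → simplex n (M ∸ (e + y)))
        ≡⟨ ∑-simplex n M e M (ℕ.m≤n+m M e) ⟩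
      simplex (suc n) (M ∸ e) ∎
      where
      open ≡-Reasoning
      e = ∣ descents x ∣

  -- Sorting permutations

  monotone⇒≤ : (f : Fin n → ℕ) → StrictlyMonotone f → ∀ i → toℕ i ≤ f i
  monotone⇒≤ {suc n} f mono zero    = z≤n
  monotone⇒≤ {suc n} f mono (suc i) =
    ℕ.≤-<-trans (monotone⇒≤ (f ∘ inject₁) mono′ i)
      (mono (Fin.≤̄⇒inject₁< ℕ.≤-refl))
    where
    mono′ : StrictlyMonotone (f ∘ inject₁)
    mono′ {j} {k} j<k = mono (subst₂ _<_ (sym (Fin.toℕ-inject₁ j)) (sym (Fin.toℕ-inject₁ k)) j<k)

  -- The inverse is strictly increasing too, so `monotone⇒≤` applies to both and bounds σ i from
  -- below and from above.
  monotone⇒id : (σ : Permutation′ n) → StrictlyMonotone (λ i → toℕ (σ ⟨$⟩ʳ i)) → ∀ i → σ ⟨$⟩ʳ i ≡ i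
  monotone⇒id {n} σ mono i = Fin.toℕ-injective (ℕ.≤-antisym
    (subst (toℕ (σ ⟨$⟩ʳ i) ≤_) (cong toℕ (inverseˡ σ)) (monotone⇒≤ (λ k → toℕ (σ ⟨$⟩ˡ k)) monoˡ (σ ⟨$⟩ʳ i)))
    (monotone⇒≤ (λ k → toℕ (σ ⟨$⟩ʳ k)) mono i))
    where
    monoˡ : StrictlyMonotone (λ k → toℕ (σ ⟨$⟩ˡ k))
    monoˡ {k} {l} k<l with Fin.<-cmp (σ ⟨$⟩ˡ k) (σ ⟨$⟩ˡ l)
    ... | tri< lt _ _ = lt
    ... | tri≈ _ eq _ = contradiction k<l (ℕ.<-irrefl (cong toℕ
      (trans (sym (inverseʳ σ)) (trans (cong (σ ⟨$⟩ʳ_) eq) (inverseʳ σ)))))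
    ... | tri> _ _ gt = contradiction k<l (ℕ.<-asym
      (subst₂ Fin._<_ (inverseʳ σ) (inverseʳ σ) (mono gt)))

  -- If k were missed, punching it out of the codomain would inject n points into n - 1.
  injective⇒surjective : (f : Fin n → Fin n) → (∀ {i j} → f i ≡ f j → i ≡ j) → ∀ k → ∃ λ i → f i ≡ k
  injective⇒surjective {suc n} f inj k with Fin.any? (λ i → f i Fin.≟ k)
  ... | yes found = found
  ... | no  missed = contradiction
    (Fin.injective⇒≤ {f = λ i → punchOut (λ eq → missed (i , sym eq))}
      (λ eq → inj (Fin.punchOut-injective (λ e → missed (_ , sym e)) (λ e → missed (_ , sym e)) eq)))
    ℕ.1+n≰n

  injective⇒permutation : (f : Fin n → Fin n) → (∀ {i j} → f i ≡ f j → i ≡ j) →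
                          ∃ λ (σ : Permutation′ n) → ∀ i → σ ⟨$⟩ʳ i ≡ f i
  injective⇒permutation f inj = permutation f (proj₁ ∘ surj) (proj₂ ∘ surj) (λ i → inj (proj₂ (surj (f i)))) , λ _ → refl
    where surj = injective⇒surjective f inj

  module _ (r : Fin n → ℕ) (r-injective : ∀ {i j} → r i ≡ r j → i ≡ j) where

    private
      below : Fin n → Subset n
      below i = tabulate λ k → does (r k ℕ.<? r i)

      below⁺ : ∀ {i k} → r k < r i → k ∈ below i
      below⁺ {i} {k} lt = Vec.lookup⇒[]= k (below i)
        (trans (Vec.lookup∘tabulate _ k) (dec-true (r k ℕ.<? r i) lt))

      below⁻ : ∀ {i k} → k ∈ below i → r k < r i
      below⁻ {i} {k} k∈ with r k ℕ.<? r i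
      ... | yes lt = lt
      ... | no ¬lt with () ← trans (sym (dec-false (r k ℕ.<? r i) ¬lt))
                              (trans (sym (Vec.lookup∘tabulate _ k)) (Vec.[]=⇒lookup k∈))

      ∣below∣<n : ∀ i → ∣ below i ∣ < n
      ∣below∣<n i = subst (∣ below i ∣ <_) (Subset.∣⊤∣≡n n) (Subset.p⊂q⇒∣p∣<∣q∣
        ((λ _ → Subset.∈⊤) , i , Subset.∈⊤ , λ i∈ → ℕ.<-irrefl refl (below⁻ i∈)))

      rank : Fin n → Fin n
      rank i = fromℕ< (∣below∣<n i)

      rank-mono : ∀ {i j} → r i < r j → rank i Fin.< rank j
      rank-mono {i} {j} lt = subst₂ _<_ (sym (Fin.toℕ-fromℕ< _)) (sym (Fin.toℕ-fromℕ< _))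
        (Subset.p⊂q⇒∣p∣<∣q∣ ((λ k∈ → below⁺ (ℕ.<-trans (below⁻ k∈) lt)) , i , below⁺ lt ,
          λ i∈ → ℕ.<-irrefl refl (below⁻ i∈)))

      rank-injective : ∀ {i j} → rank i ≡ rank j → i ≡ j
      rank-injective {i} {j} eq with ℕ.<-cmp (r i) (r j)
      ... | tri< lt _ _ = contradiction (rank-mono lt) (ℕ.<-irrefl (cong toℕ eq))
      ... | tri≈ _ r≡ _ = r-injective r≡
      ... | tri> _ _ gt = contradiction (rank-mono gt) (ℕ.<-irrefl (cong toℕ (sym eq)))

      rankPermutation = injective⇒permutation rank rank-injective

    -- The standardization of r: i is sent to the number of entries smaller than r i, so reading r
    -- along the inverse lists its values in increasing order.
    sorting : Permutation′ n
    sorting = proj₁ rankPermutation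

    sorting-< : ∀ {i j} → r i < r j → sorting ⟨$⟩ʳ i Fin.< sorting ⟨$⟩ʳ j
    sorting-< {i} {j} lt = rank-mono lt

    sorting-<⁻ : ∀ {i j} → sorting ⟨$⟩ʳ i Fin.< sorting ⟨$⟩ʳ j → r i < r j
    sorting-<⁻ {i} {j} lt with ℕ.<-cmp (r i) (r j)
    ... | tri< ri<rj _ _ = ri<rj
    ... | tri≈ _ eq _ = contradiction lt (ℕ.<-irrefl (cong (toℕ ∘ (sorting ⟨$⟩ʳ_)) (r-injective eq)))
    ... | tri> _ _ gt = contradiction lt (ℕ.<-asym (sorting-< gt))

    -- The inverse of τ followed by `sorting` is a strictly increasing permutation, hence the
    -- identity.
    sorting-unique : ∀ τ → Increasing (λ k → r (τ ⟨$⟩ˡ k)) → τ Perm.≈ sorting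
    sorting-unique τ inc i = trans
      (sym (monotone⇒id (flip τ ∘ₚ sorting)
        (λ k<l → sorting-< (increasing⇒monotone (λ k → r (τ ⟨$⟩ˡ k)) inc k<l)) (τ ⟨$⟩ʳ i)))
      (cong (sorting ⟨$⟩ʳ_) (inverseˡ τ))

    sorting-increasing : ∀ τ → τ Perm.≈ sorting → Increasing (λ k → r (τ ⟨$⟩ˡ k))
    sorting-increasing τ τ≈ = monotone⇒increasing (λ k → r (τ ⟨$⟩ˡ k)) λ {k} {l} k<l →
      sorting-<⁻ (subst₂ Fin._<_ (lemma k) (lemma l) k<l)
      where
      lemma : ∀ k → k ≡ sorting ⟨$⟩ʳ (τ ⟨$⟩ˡ k)
      lemma k = trans (sym (inverseʳ τ)) (τ≈ (τ ⟨$⟩ˡ k))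

  -- Words over pairs of letters and the product identity

  ∑-tuples-zip : ∀ k (xs : List A) (ys : List B) (f : Vec (A × B) k → ℕ) →
    ∑ (tuples k (cartesianProductWith _,_ xs ys)) f ≡ ∑ (tuples k xs) (λ v → ∑ (tuples k ys) λ w → f (Vec.zip v w))
  ∑-tuples-zip zero    xs ys f = trans ∑-singleton (sym (trans ∑-singleton ∑-singleton))
  ∑-tuples-zip (suc k) xs ys f = begin
    ∑ (tuples (suc k) (cartesianProductWith _,_ xs ys)) f
      ≡⟨ ∑-cartesianProductWith _∷_ (cartesianProductWith _,_ xs ys) (tuples k _) f ⟩
    ∑ (cartesianProductWith _,_ xs ys) (λ z → ∑ (tuples k _) λ u → f (z ∷ u))
      ≡⟨ ∑-cartesianProductWith _,_ xs ys _ ⟩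
    ∑ xs (λ x → ∑ ys λ y → ∑ (tuples k _) λ u → f ((x , y) ∷ u))
      ≡⟨ ∑-cong xs (λ x → ∑-cong ys λ y → ∑-tuples-zip k xs ys (λ u → f ((x , y) ∷ u))) ⟩
    ∑ xs (λ x → ∑ ys λ y → ∑ (tuples k xs) λ v → ∑ (tuples k ys) λ w → f ((x , y) ∷ Vec.zip v w))
      ≡⟨ ∑-cong xs (λ x → ∑-swap ys (tuples k xs) _) ⟩
    ∑ xs (λ x → ∑ (tuples k xs) λ v → ∑ ys λ y → ∑ (tuples k ys) λ w → f ((x , y) ∷ Vec.zip v w))
      ≡⟨ ∑-cong xs (λ x → ∑-cong (tuples k xs) λ v → ∑-cartesianProductWith _∷_ ys (tuples k ys) _) ⟨
    ∑ xs (λ x → ∑ (tuples k xs) λ v → ∑ (tuples (suc k) ys) λ w → f (Vec.zip (x ∷ v) w))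
      ≡⟨ ∑-cartesianProductWith _∷_ xs (tuples k xs) _ ⟨
    ∑ (tuples (suc k) xs) (λ v → ∑ (tuples (suc k) ys) λ w → f (Vec.zip v w)) ∎
    where open ≡-Reasoning

  ∑-tuples-permute : ∀ b (σ : Permutation′ n) (f : Vec (Fin b) n → ℕ) →
    ∑ (tuples n (allFin b)) (λ v → f (tabulate λ k → lookup v (σ ⟨$⟩ʳ k))) ≡ ∑ (tuples n (allFin b)) f
  ∑-tuples-permute {n} b σ f = ∑-reindex
    (Vec.≡-dec Fin._≟_) (tuples-enumerate n Fin._≟_ (allFin-enumerates b)) (λ _ _ → cong f)
    (permute σ) (permute (flip σ))
    (λ { _ _ refl → sym (permute-inverse (flip σ) σ (λ _ → inverseʳ σ) _) })
    (λ { _ _ refl → sym (permute-inverse σ (flip σ) (λ _ → inverseˡ σ) _) })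
    where
    permute : Permutation′ n → Vec (Fin b) n → Vec (Fin b) n
    permute τ v = tabulate λ k → lookup v (τ ⟨$⟩ʳ k)
    permute-inverse : ∀ τ ρ → (∀ i → ρ ⟨$⟩ʳ (τ ⟨$⟩ʳ i) ≡ i) → ∀ v → permute τ (permute ρ v) ≡ v
    permute-inverse τ ρ inv v = trans
      (Vec.tabulate-cong λ k → trans (Vec.lookup∘tabulate _ (τ ⟨$⟩ʳ k)) (cong (lookup v) (inv k)))
      (Vec.tabulate∘lookup v)

  increasing-cong : (c c′ : Fin n → ℕ) → (∀ i → c i ≡ c′ i) → ⟦ increasing? c ⟧ ≡ ⟦ increasing? c′ ⟧
  increasing-cong c c′ eq = ⟦⟧-cong (increasing? c) (increasing? c′)
    (increasing-map c c′ λ i j → subst₂ _<_ (eq i) (eq j))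
    (increasing-map c′ c λ i j → subst₂ _<_ (sym (eq i)) (sym (eq j)))

  ⟨$⟩ʳ-injective : (σ : Permutation′ n) → ∀ {i j} → toℕ (σ ⟨$⟩ʳ i) ≡ toℕ (σ ⟨$⟩ʳ j) → i ≡ j
  ⟨$⟩ʳ-injective σ eq = trans (sym (inverseˡ σ)) (trans (cong (σ ⟨$⟩ˡ_) (Fin.toℕ-injective eq)) (inverseˡ σ))

  -- Condenses a mixed condition into one: for these codes to increase strictly, v must increase
  -- weakly, and strictly where σ descends.
  tieBreak : ∀ {b} → Vec (Fin b) n → Permutation′ n → Fin n → ℕ
  tieBreak {n} v σ i = toℕ (lookup v i) * n + toℕ (σ ⟨$⟩ʳ i)

  tieBreak-injective : ∀ {b} (v : Vec (Fin b) n) σ → ∀ {i j} → tieBreak v σ i ≡ tieBreak v σ j → i ≡ j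
  tieBreak-injective {n} v σ {i} {j} eq with ℕ.<-cmp (toℕ (lookup v i)) (toℕ (lookup v j))
  ... | tri< lt _ _ = contradiction eq (ℕ.<⇒≢ (lex-<⁺ lt (Fin.toℕ<n (σ ⟨$⟩ʳ i))))
  ... | tri> _ _ gt = contradiction (sym eq) (ℕ.<⇒≢ (lex-<⁺ gt (Fin.toℕ<n (σ ⟨$⟩ʳ j))))
  ... | tri≈ _ e _  = ⟨$⟩ʳ-injective σ (ℕ.+-cancelˡ-≡ (toℕ (lookup v j) * n) _ _
    (trans (cong (λ l → l * n + _) (sym e)) eq))

  ∑-tieBreak : ∀ b (σ : Permutation′ (suc m)) →
    ∑ (tuples (suc m) (allFin b)) (λ v → ⟦ increasing? (tieBreak v σ) ⟧) ≡ simplex (suc m) (b ∸ d σ)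
  ∑-tieBreak b σ = ∑-increasing b Fin.toℕ<n (∑-allFin b) _ _ (⟨$⟩ʳ-injective σ) (λ i → Fin.toℕ<n (σ ⟨$⟩ʳ i))

  ∑-tieBreak-pairs : ∀ a b (σ : Permutation′ (suc m)) →
    ∑ (tuples (suc m) (allFin a)) (λ f → ∑ (tuples (suc m) (allFin b)) λ q →
      ⟦ increasing? (λ i → (toℕ (lookup f i) * b + toℕ (lookup q i)) * suc m + toℕ (σ ⟨$⟩ʳ i)) ⟧)
    ≡ simplex (suc m) (a * b ∸ d σ)
  ∑-tieBreak-pairs {m} a b σ = begin
    ∑ (tuples n′ (allFin a)) (λ f → ∑ (tuples n′ (allFin b)) λ q →
      ⟦ increasing? (λ i → (toℕ (lookup f i) * b + toℕ (lookup q i)) * n′ + toℕ (σ ⟨$⟩ʳ i)) ⟧)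
      ≡⟨ ∑-cong (tuples n′ (allFin a)) (λ f → ∑-cong (tuples n′ (allFin b)) λ q →
           increasing-cong _ _ λ i → cong (λ z → κ z * n′ + toℕ (σ ⟨$⟩ʳ i)) (sym (Vec.lookup-zip i f q))) ⟩
    ∑ (tuples n′ (allFin a)) (λ f → ∑ (tuples n′ (allFin b)) λ q →
      ⟦ increasing? (λ i → κ (lookup (Vec.zip f q) i) * n′ + toℕ (σ ⟨$⟩ʳ i)) ⟧)
      ≡⟨ ∑-tuples-zip n′ (allFin a) (allFin b) _ ⟨
    ∑ (tuples n′ (cartesianProductWith _,_ (allFin a) (allFin b))) (λ v →
      ⟦ increasing? (λ i → κ (lookup v i) * n′ + toℕ (σ ⟨$⟩ʳ i)) ⟧)
      ≡⟨ ∑-increasing (a * b) κ<ab ∑-κ _ _ (⟨$⟩ʳ-injective σ) (λ i → Fin.toℕ<n (σ ⟨$⟩ʳ i)) ⟩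
    simplex n′ (a * b ∸ d σ) ∎
    where
    open ≡-Reasoning
    n′ = suc m
    κ : Fin a × Fin b → ℕ
    κ (p , q) = toℕ p * b + toℕ q
    κ<ab : ∀ u → κ u < a * b
    κ<ab (p , q) = subst (κ (p , q) <_) (ℕ.+-identityʳ (a * b)) (lex-<⁺ (Fin.toℕ<n p) (Fin.toℕ<n q))
    ∑-κ : ∀ f → ∑ (cartesianProductWith _,_ (allFin a) (allFin b)) (f ∘ κ) ≡ ∑ (upTo (a * b)) f
    ∑-κ f = begin
      ∑ (cartesianProductWith _,_ (allFin a) (allFin b)) (f ∘ κ)
        ≡⟨ ∑-cartesianProductWith _,_ (allFin a) (allFin b) _ ⟩
      ∑ (allFin a) (λ p → ∑ (allFin b) λ q → f (toℕ p * b + toℕ q))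
        ≡⟨ ∑-cong (allFin a) (λ p → ∑-allFin b λ q → f (toℕ p * b + q)) ⟩
      ∑ (allFin a) (λ p → ∑ (upTo b) λ q → f (toℕ p * b + q))
        ≡⟨ ∑-allFin a (λ p → ∑ (upTo b) λ q → f (p * b + q)) ⟩
      ∑ (upTo a) (λ p → ∑ (upTo b) λ q → f (p * b + q))
        ≡⟨ ∑-upTo-* a b f ⟨
      ∑ (upTo (a * b)) f ∎

  -- Since `sorting` orders positions exactly as r does, ties of f may be broken by r itself, that
  -- is by q and then by x. Regrouping the resulting triples makes the letters of f and q a single
  -- letter of the alphabet of pairs.
  tieBreak-sorting : ∀ {a b} (f : Vec (Fin a) n) (q : Vec (Fin b) n) (x : Permutation′ n) →
    let r = tieBreak q x ; σ = sorting r (tieBreak-injective q x) in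
    ⟦ increasing? (tieBreak f σ) ⟧
    ≡ ⟦ increasing? (λ i → (toℕ (lookup f i) * b + toℕ (lookup q i)) * n + toℕ (x ⟨$⟩ʳ i)) ⟧
  tieBreak-sorting {n} {a} {b} f q x = ⟦⟧-cong (increasing? (tieBreak f σ)) (increasing? c)
    (increasing-map (tieBreak f σ) c to) (increasing-map c (tieBreak f σ) from)
    where
    r = tieBreak q x
    σ = sorting r (tieBreak-injective q x)
    c = λ i → (toℕ (lookup f i) * b + toℕ (lookup q i)) * n + toℕ (x ⟨$⟩ʳ i)
    c≡ : ∀ i → c i ≡ toℕ (lookup f i) * (b * n) + r i
    c≡ i = distribute (toℕ (lookup f i)) b (toℕ (lookup q i)) n (toℕ (x ⟨$⟩ʳ i))
      where
      distribute : ∀ p b q n y → (p * b + q) * n + y ≡ p * (b * n) + (q * n + y)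
      distribute = solve-∀
    r<bn : ∀ i → r i < b * n
    r<bn i = subst (r i <_) (ℕ.+-identityʳ (b * n)) (lex-<⁺ (Fin.toℕ<n (lookup q i)) (Fin.toℕ<n (x ⟨$⟩ʳ i)))
    to : ∀ i j → tieBreak f σ i < tieBreak f σ j → c i < c j
    to i j = subst₂ _<_ (sym (c≡ i)) (sym (c≡ j)) ∘
      lex-map {p = toℕ (lookup f i)} {p′ = toℕ (lookup f j)} (Fin.toℕ<n (σ ⟨$⟩ʳ j)) (r<bn i)
        (sorting-<⁻ r (tieBreak-injective q x))
    from : ∀ i j → c i < c j → tieBreak f σ i < tieBreak f σ j
    from i j = lex-map {p = toℕ (lookup f i)} {p′ = toℕ (lookup f j)} (r<bn j) (Fin.toℕ<n (σ ⟨$⟩ʳ i))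
        (sorting-< r (tieBreak-injective q x)) ∘
      subst₂ _<_ (c≡ i) (c≡ j)

  -- For each word q there is exactly one σ that sorts it with ties broken by x, and the first
  -- factor counts the q belonging to σ. The second counts the f that increase with ties broken by
  -- σ; together f and q form a word over pairs that increases with ties broken by x. In the group
  -- algebra: the elements Σ_σ G(a - d(σ)) σ multiply like the numbers a.
  ∑-perms-simplex : ∀ a b (x : Permutation′ (suc m)) →
    ∑ (perms (suc m)) (λ σ → simplex (suc m) (b ∸ d (flip σ ∘ₚ x)) * simplex (suc m) (a ∸ d σ))
    ≡ simplex (suc m) (a * b ∸ d x)
  ∑-perms-simplex {m} a b x = begin
    ∑ (perms n′) (λ σ → simplex n′ (b ∸ d (flip σ ∘ₚ x)) * simplex n′ (a ∸ d σ))
      ≡⟨ ∑-cong (perms n′) (λ σ → cong₂ _*_ (sorted σ) (∑-tieBreak a σ)) ⟨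
    ∑ (perms n′) (λ σ → ∑ qs (λ q → ⟦ σ ≈? sort q ⟧) * ∑ fs (λ f → ⟦ increasing? (tieBreak f σ) ⟧))
      ≡⟨ ∑-cong (perms n′) (λ σ → trans (∑-⊗ qs _ _) (∑-cong qs λ q → ⊗-∑ ⟦ σ ≈? sort q ⟧ fs _)) ⟩
    ∑ (perms n′) (λ σ → ∑ qs λ q → ∑ fs λ f → ⟦ σ ≈? sort q ⟧ * ⟦ increasing? (tieBreak f σ) ⟧)
      ≡⟨ ∑-swap (perms n′) qs _ ⟩
    ∑ qs (λ q → ∑ (perms n′) λ σ → ∑ fs λ f → ⟦ σ ≈? sort q ⟧ * ⟦ increasing? (tieBreak f σ) ⟧)
      ≡⟨ ∑-cong qs (λ q → ∑-swap (perms n′) fs _) ⟩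
    ∑ qs (λ q → ∑ fs λ f → ∑ (perms n′) λ σ → ⟦ σ ≈? sort q ⟧ * ⟦ increasing? (tieBreak f σ) ⟧)
      ≡⟨ ∑-cong qs (λ q → ∑-cong fs λ f → ∑-select _≈?_ (perms-enumerate n′) (tieBreak-cong f) (sort q)) ⟩
    ∑ qs (λ q → ∑ fs λ f → ⟦ increasing? (tieBreak f (sort q)) ⟧)
      ≡⟨ ∑-swap qs fs _ ⟩
    ∑ fs (λ f → ∑ qs λ q → ⟦ increasing? (tieBreak f (sort q)) ⟧)
      ≡⟨ ∑-cong fs (λ f → ∑-cong qs λ q → tieBreak-sorting f q x) ⟩
    ∑ fs (λ f → ∑ qs λ q → ⟦ increasing? (λ i → (toℕ (lookup f i) * b + toℕ (lookup q i)) * n′ + toℕ (x ⟨$⟩ʳ i)) ⟧)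
      ≡⟨ ∑-tieBreak-pairs a b x ⟩
    simplex n′ (a * b ∸ d x) ∎
    where
    open ≡-Reasoning
    n′ = suc m
    fs = tuples n′ (allFin a)
    qs = tuples n′ (allFin b)
    sort : Vec (Fin b) n′ → Permutation′ n′
    sort q = sorting (tieBreak q x) (tieBreak-injective q x)
    tieBreak-cong : ∀ (f : Vec (Fin a) n′) (σ τ : Permutation′ n′) → σ Perm.≈ τ →
                    ⟦ increasing? (tieBreak f σ) ⟧ ≡ ⟦ increasing? (tieBreak f τ) ⟧
    tieBreak-cong f σ τ eq = increasing-cong _ _ λ i → cong (λ k → toℕ (lookup f i) * n′ + toℕ k) (eq i)
    sorted : ∀ σ → ∑ qs (λ q → ⟦ σ ≈? sort q ⟧) ≡ simplex n′ (b ∸ d (flip σ ∘ₚ x))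
    sorted σ = begin
      ∑ qs (λ q → ⟦ σ ≈? sort q ⟧)
        ≡⟨ ∑-cong qs (λ q → ⟦⟧-cong (σ ≈? sort q) (increasing? (λ k → tieBreak q x (σ ⟨$⟩ˡ k)))
             (sorting-increasing (tieBreak q x) (tieBreak-injective q x) σ)
             (sorting-unique (tieBreak q x) (tieBreak-injective q x) σ)) ⟩
      ∑ qs (λ q → ⟦ increasing? (λ k → tieBreak q x (σ ⟨$⟩ˡ k)) ⟧)
        ≡⟨ ∑-cong qs (λ q → increasing-cong _ _ λ k →
             cong (λ l → toℕ l * n′ + toℕ (x ⟨$⟩ʳ (σ ⟨$⟩ˡ k))) (sym (Vec.lookup∘tabulate (λ k → lookup q (σ ⟨$⟩ˡ k)) k))) ⟩
      ∑ qs (λ q → ⟦ increasing? (tieBreak (tabulate λ k → lookup q (σ ⟨$⟩ˡ k)) (flip σ ∘ₚ x)) ⟧)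
        ≡⟨ ∑-tuples-permute b (flip σ) _ ⟩
      ∑ qs (λ g → ⟦ increasing? (tieBreak g (flip σ ∘ₚ x)) ⟧)
        ≡⟨ ∑-tieBreak b (flip σ ∘ₚ x) ⟩
      simplex n′ (b ∸ d (flip σ ∘ₚ x)) ∎

-- Inversion by finite differences

open import Data.Integer.Base using (+_)

opaque
  unfolding BigSum.∑

  +-∑ : ∀ (xs : List A) f → + Σℕ.∑ xs f ≡ Σℤ.∑ xs (+_ ∘ f)
  +-∑ []       f = refl
  +-∑ (x ∷ xs) f = trans (ℤ.pos-+ (f x) _) (cong (ℤ._+_ (+ f x)) (+-∑ xs f))

+-⟦⟧ : ∀ {P : Set} (P? : Dec P) → + Σℕ.⟦ P? ⟧ ≡ Σℤ.⟦ P? ⟧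
+-⟦⟧ (yes _) = refl
+-⟦⟧ (no _)  = refl

module _ where

  open import Data.Nat.Base using (_+_; _*_; _<_)
  open Σℤ

  -- With u taken as zero before index 0, this multiplies the generating function of u by 1 - x.
  difference : (ℕ → ℤ) → ℕ → ℤ
  difference u zero    = u zero
  difference u (suc i) = u (suc i) ℤ.- u i

  differences : ℕ → (ℕ → ℤ) → ℕ → ℤ
  differences zero    u = u
  differences (suc n) u = differences n (difference u)

  difference-cong : ∀ {u v} → (∀ i → u i ≡ v i) → ∀ i → difference u i ≡ difference v i
  difference-cong eq zero    = eq zero
  difference-cong eq (suc i) = cong₂ ℤ._-_ (eq (suc i)) (eq i)

  differences-cong : ∀ n {u v} → (∀ i → u i ≡ v i) → ∀ i → differences n u i ≡ differences n v i
  differences-cong zero    eq = eq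
  differences-cong (suc n) eq = differences-cong n (difference-cong eq)

  differences-suc : ∀ n u i → differences (suc n) u i ≡ difference (differences n u) i
  differences-suc zero    u i = refl
  differences-suc (suc n) u i = differences-suc n (difference u) i

  alternating : ℕ → ℕ → ℤ
  alternating n l = -1ℤ ℤ.^ l ℤ.* + (n C l)

  alternating-suc : ∀ n l → alternating (suc n) (suc l) ≡ alternating n (suc l) ℤ.- alternating n l
  alternating-suc n l = begin
    -1ℤ ℤ.* s ℤ.* + (suc n C suc l)          ≡⟨ cong (λ k → -1ℤ ℤ.* s ℤ.* + k) (nCk+nC[k+1]≡[n+1]C[k+1] n l) ⟨
    -1ℤ ℤ.* s ℤ.* + (n C l + n C suc l)      ≡⟨ cong (-1ℤ ℤ.* s ℤ.*_) (ℤ.pos-+ (n C l) (n C suc l)) ⟩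
    -1ℤ ℤ.* s ℤ.* (+ (n C l) ℤ.+ + (n C suc l)) ≡⟨ expand s (+ (n C l)) (+ (n C suc l)) ⟩
    -1ℤ ℤ.* s ℤ.* + (n C suc l) ℤ.- s ℤ.* + (n C l) ∎
    where
    open ≡-Reasoning
    s = -1ℤ ℤ.^ l
    expand : ∀ s a b → -1ℤ ℤ.* s ℤ.* (a ℤ.+ b) ≡ -1ℤ ℤ.* s ℤ.* b ℤ.- s ℤ.* a
    expand = ℤ-Solver.solve-∀

  -- The coefficients of (1 - x)^n, convolved with u; the induction is Pascal's rule with signs.
  ∑-alternating : ∀ n u i →
    ∑ (upTo (suc i)) (λ l → alternating n l ℤ.* u (i ∸ l)) ≡ differences n u i
  ∑-alternating zero u i = begin
    ∑ (upTo (suc i)) (λ l → alternating 0 l ℤ.* u (i ∸ l))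
      ≡⟨ ∑-upTo-suc i _ ⟩
    1ℤ ℤ.* u i ℤ.+ ∑ (upTo i) (λ l → alternating 0 (suc l) ℤ.* u (i ∸ suc l))
      ≡⟨ cong₂ ℤ._+_ (ℤ.*-identityˡ (u i)) (trans (∑-cong (upTo i) λ l →
           cong (ℤ._* u (i ∸ suc l)) (ℤ.*-zeroʳ (-1ℤ ℤ.^ suc l))) (∑-zero (upTo i))) ⟩
    u i ℤ.+ 0ℤ
      ≡⟨ ℤ.+-identityʳ (u i) ⟩
    u i ∎
    where open ≡-Reasoning
  ∑-alternating (suc n) u i = trans (lemma i) (trans
    (difference-cong (∑-alternating n u) i) (sym (differences-suc n u i)))
    where
    open ≡-Reasoning
    lemma : ∀ i → ∑ (upTo (suc i)) (λ l → alternating (suc n) l ℤ.* u (i ∸ l)) ≡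
                  difference (λ i → ∑ (upTo (suc i)) (λ l → alternating n l ℤ.* u (i ∸ l))) i
    lemma zero    = trans ∑-singleton (sym ∑-singleton)
    lemma (suc i) = begin
      ∑ (upTo (suc (suc i))) (λ l → alternating (suc n) l ℤ.* u (suc i ∸ l))
        ≡⟨ ∑-upTo-suc (suc i) _ ⟩
      x ℤ.+ ∑ (upTo (suc i)) (λ l → alternating (suc n) (suc l) ℤ.* u (i ∸ l))
        ≡⟨ cong (ℤ._+_ x) (∑-cong (upTo (suc i)) λ l → trans
             (cong (ℤ._* u (i ∸ l)) (alternating-suc n l))
             (distrib (alternating n (suc l)) (alternating n l) (u (i ∸ l)))) ⟩
      x ℤ.+ ∑ (upTo (suc i)) (λ l → alternating n (suc l) ℤ.* u (i ∸ l) ℤ.+ -1ℤ ℤ.* (alternating n l ℤ.* u (i ∸ l)))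
        ≡⟨ cong (ℤ._+_ x) (trans (∑-⊕ (upTo (suc i)) _ _) (cong (ℤ._+_ y) (sym (⊗-∑ -1ℤ (upTo (suc i)) _)))) ⟩
      x ℤ.+ (y ℤ.+ -1ℤ ℤ.* z)
        ≡⟨ regroup x y z ⟩
      (x ℤ.+ y) ℤ.- z
        ≡⟨ cong (ℤ._- z) (∑-upTo-suc (suc i) _) ⟨
      ∑ (upTo (suc (suc i))) (λ l → alternating n l ℤ.* u (suc i ∸ l)) ℤ.- z ∎
      where
      x = 1ℤ ℤ.* u (suc i)
      y = ∑ (upTo (suc i)) (λ l → alternating n (suc l) ℤ.* u (i ∸ l))
      z = ∑ (upTo (suc i)) (λ l → alternating n l ℤ.* u (i ∸ l))
      distrib : ∀ a b v → (a ℤ.- b) ℤ.* v ≡ a ℤ.* v ℤ.+ -1ℤ ℤ.* (b ℤ.* v)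
      distrib = ℤ-Solver.solve-∀
      regroup : ∀ x y z → x ℤ.+ (y ℤ.+ -1ℤ ℤ.* z) ≡ (x ℤ.+ y) ℤ.- z
      regroup = ℤ-Solver.solve-∀

  simplex-pred : ∀ n N → simplex (suc n) N ≡ simplex n N + simplex (suc n) (N ∸ 1)
  simplex-pred n zero    = cong (_+ 0) (sym (simplex-zero n))
  simplex-pred n (suc N) = refl

  -- Pascal's recurrence lowers the dimension by one. Index i stands for a = i + 1, so the value
  -- before index 0 belongs to a = 0, where the count is zero as `difference` assumes.
  difference-simplex : ∀ n j i →
    difference (λ i → + simplex (suc n) (suc i ∸ j)) i ≡ + simplex n (suc i ∸ j)
  difference-simplex n j zero    = cong +_ (begin
    simplex (suc n) (1 ∸ j)                              ≡⟨ simplex-pred n (1 ∸ j) ⟩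
    simplex n (1 ∸ j) + simplex (suc n) (1 ∸ j ∸ 1)
      ≡⟨ cong (λ N → simplex n (1 ∸ j) + simplex (suc n) N) (1∸j∸1 j) ⟩
    simplex n (1 ∸ j) + 0                                ≡⟨ ℕ.+-identityʳ _ ⟩
    simplex n (1 ∸ j)                                    ∎)
    where
    open ≡-Reasoning
    1∸j∸1 : ∀ j → 1 ∸ j ∸ 1 ≡ 0
    1∸j∸1 j = trans (ℕ.∸-+-assoc 1 j 1) (trans (cong (1 ∸_) (ℕ.+-comm j 1)) (ℕ.0∸n≡0 j))
  difference-simplex n j (suc i) = begin
    + simplex (suc n) N ℤ.- + simplex (suc n) (suc i ∸ j)
      ≡⟨ cong (λ k → + k ℤ.- + simplex (suc n) (suc i ∸ j)) (trans (simplex-pred n N)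
           (cong (λ l → simplex n N + simplex (suc n) l) N∸1)) ⟩
    + (simplex n N + simplex (suc n) (suc i ∸ j)) ℤ.- + simplex (suc n) (suc i ∸ j)
      ≡⟨ cong (ℤ._- + simplex (suc n) (suc i ∸ j)) (ℤ.pos-+ (simplex n N) _) ⟩
    (+ simplex n N ℤ.+ + simplex (suc n) (suc i ∸ j)) ℤ.- + simplex (suc n) (suc i ∸ j)
      ≡⟨ cancel (+ simplex n N) (+ simplex (suc n) (suc i ∸ j)) ⟩
    + simplex n N ∎
    where
    open ≡-Reasoning
    N = suc (suc i) ∸ j
    N∸1 : N ∸ 1 ≡ suc i ∸ j
    N∸1 = trans (ℕ.∸-+-assoc (suc (suc i)) j 1) (cong (suc (suc i) ∸_) (ℕ.+-comm j 1))
    cancel : ∀ a b → (a ℤ.+ b) ℤ.- b ≡ a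
    cancel = ℤ-Solver.solve-∀

  -- The generating function of this sequence is x^j / (1 - x)^(n + 1). In the induction n
  -- differences bring the dimension down to 0, where a step function is left whose jump is at j.
  differences-simplex : ∀ n j i → differences (suc n) (λ i → + simplex n (suc i ∸ j)) i ≡ ⟦ j ℕ.≟ i ⟧
  differences-simplex zero    zero    zero          = refl
  differences-simplex zero    (suc j) zero          = cong (λ N → + simplex 0 N) (ℕ.0∸n≡0 j)
  differences-simplex zero    zero    (suc i)       = refl
  differences-simplex zero    (suc zero) (suc zero) = refl
  differences-simplex zero    (suc (suc j)) (suc zero) =
    cong (λ N → + simplex 0 N ℤ.- 0ℤ) (ℕ.0∸n≡0 j)
  differences-simplex zero    (suc j) (suc (suc i)) = differences-simplex zero j (suc i)
  differences-simplex (suc n) j       i             = trans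
    (differences-cong (suc n) (difference-simplex n j) i) (differences-simplex n j i)

  -- Here j is the old carry and i the new one. The bound l ≤ i keeps `i + 1 ∸ l` from being cut
  -- off, so that it equals the letter count `suc (i ∸ l)` of the differences.
  carryTerm-simplex : ∀ m b j i l → j ≤ m → l ≤ i →
    carryTerm (suc m) b j i l ≡ alternating (suc (suc m)) l ℤ.* + simplex (suc m) (suc (i ∸ l) * b ∸ j)
  carryTerm-simplex m b j i l j≤m l≤i = cong₂ (λ k x → -1ℤ ℤ.^ l ℤ.* + (k C l) ℤ.* + x)
    (ℕ.+-comm (suc m) 1)
    (trans (cong (λ c → (m ∸ j + c * b) C suc m) (trans (cong (_∸ l) (ℕ.+-comm i 1)) (ℕ.+-∸-assoc 1 l≤i)))
      (simplex-∸-C (suc (i ∸ l) * b) j≤m))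

  -- For these l, i + 1 - l is at most ⌊j / b⌋, so (i + 1 - l) b ≤ j and no lattice points are left.
  -- This reconciles the upper limit of the sum in P_b with the full range l ≤ i of the differences.
  carryTerm-vanishes : ∀ m b .{{_ : NonZero b}} j i l → j ≤ m → l ≤ i → i + 1 ∸ j ℕ./ b ≤ l →
                       carryTerm (suc m) b j i l ≡ 0ℤ
  carryTerm-vanishes m b j i l j≤m l≤i i+1∸q≤l = begin
    carryTerm (suc m) b j i l
      ≡⟨ carryTerm-simplex m b j i l j≤m l≤i ⟩
    alternating (suc (suc m)) l ℤ.* + simplex (suc m) (suc (i ∸ l) * b ∸ j)
      ≡⟨ cong (λ N → alternating (suc (suc m)) l ℤ.* + simplex (suc m) N) (ℕ.m≤n⇒m∸n≡0 small) ⟩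
    alternating (suc (suc m)) l ℤ.* 0ℤ
      ≡⟨ ℤ.*-zeroʳ (alternating (suc (suc m)) l) ⟩
    0ℤ ∎
    where
    open ≡-Reasoning
    i+1≤q+l : i + 1 ≤ j ℕ./ b + l
    i+1≤q+l = ℕ.≤-trans (ℕ.m≤n+m∸n (i + 1) (j ℕ./ b)) (ℕ.+-monoʳ-≤ (j ℕ./ b) i+1∸q≤l)
    small : suc (i ∸ l) * b ≤ j
    small = ℕ.≤-trans (ℕ.*-monoˡ-≤ b (subst (_≤ j ℕ./ b) (trans (cong (_∸ l) (ℕ.+-comm i 1)) (ℕ.+-∸-assoc 1 l≤i))
        (ℕ.m≤n+o⇒m∸n≤o (i + 1) l (subst (i + 1 ≤_) (ℕ.+-comm (j ℕ./ b) l) i+1≤q+l))))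
      (DivMod.m/n*n≤m j b)

  -- The numbers simplex n (a ∸ φ), a ≥ 1, determine the distribution of φ:
  -- taking n + 1 differences in a recovers the indicator of φ = i.
  ∑-≟-carryTerm : ∀ {m} b .{{_ : NonZero b}} {j} → j ≤ m → ∀ (xs : List A) (φ w : A → ℕ) →
    (∀ a → Σℕ.∑ xs (λ x → w x * simplex (suc m) (a ∸ φ x)) ≡ simplex (suc m) (a * b ∸ j)) →
    ∀ i → + Σℕ.∑ xs (λ x → w x * Σℕ.⟦ φ x ℕ.≟ i ⟧)
          ≡ sumℤ (List.map (carryTerm (suc m) b j i) (upTo (i + 1 ∸ j ℕ./ b)))
  ∑-≟-carryTerm {m = m} b {j} j≤m xs φ w h i = begin
    + Σℕ.∑ xs (λ x → w x * Σℕ.⟦ φ x ℕ.≟ i ⟧)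
      ≡⟨ +-∑ xs _ ⟩
    ∑ xs (λ x → + (w x * Σℕ.⟦ φ x ℕ.≟ i ⟧))
      ≡⟨ ∑-cong xs (λ x → trans (ℤ.pos-* (w x) _) (cong (+ w x ℤ.*_) (trans (+-⟦⟧ (φ x ℕ.≟ i))
           (sym (trans (∑-alternating (suc n′) _ i) (differences-simplex n′ (φ x) i)))))) ⟩
    ∑ xs (λ x → + w x ℤ.* ∑ ls (λ l → alternating (suc n′) l ℤ.* + simplex n′ (suc (i ∸ l) ∸ φ x)))
      ≡⟨ ∑-cong xs (λ x → ⊗-∑ (+ w x) ls _) ⟩
    ∑ xs (λ x → ∑ ls λ l → + w x ℤ.* (alternating (suc n′) l ℤ.* + simplex n′ (suc (i ∸ l) ∸ φ x)))
      ≡⟨ ∑-swap xs ls _ ⟩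
    ∑ ls (λ l → ∑ xs λ x → + w x ℤ.* (alternating (suc n′) l ℤ.* + simplex n′ (suc (i ∸ l) ∸ φ x)))
      ≡⟨ ∑-cong ls (λ l → trans (∑-cong xs λ x → trans
             (left-comm (+ w x) (alternating (suc n′) l) _)
             (cong (alternating (suc n′) l ℤ.*_) (sym (ℤ.pos-* (w x) _))))
           (sym (⊗-∑ (alternating (suc n′) l) xs _))) ⟩
    ∑ ls (λ l → alternating (suc n′) l ℤ.* ∑ xs (λ x → + (w x * simplex n′ (suc (i ∸ l) ∸ φ x))))
      ≡⟨ ∑-cong ls (λ l → cong (alternating (suc n′) l ℤ.*_) (trans (sym (+-∑ xs _)) (cong +_ (h (suc (i ∸ l)))))) ⟩
    ∑ ls (λ l → alternating (suc n′) l ℤ.* + simplex n′ (suc (i ∸ l) * b ∸ j))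
      ≡⟨ ∑-upTo-cong (suc i) (λ l l<1+i → carryTerm-simplex m b j i l j≤m (ℕ.s≤s⁻¹ l<1+i)) ⟨
    ∑ ls (carryTerm n′ b j i)
      ≡⟨ ∑-upTo-extend _ (ℕ.≤-trans (ℕ.m∸n≤m (i + 1) (j ℕ./ b)) (ℕ.≤-reflexive (ℕ.+-comm i 1)))
           (λ l ≤l l<1+i → carryTerm-vanishes m b j i l j≤m (ℕ.s≤s⁻¹ l<1+i) ≤l) ⟨
    ∑ (upTo (i + 1 ∸ j ℕ./ b)) (carryTerm n′ b j i)
      ≡⟨ ∑-foldr (upTo (i + 1 ∸ j ℕ./ b)) _ ⟩
    sumℤ (List.map (carryTerm n′ b j i) (upTo (i + 1 ∸ j ℕ./ b))) ∎
    where
    open ≡-Reasoning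
    n′ = suc m
    ls = upTo (suc i)
    left-comm : ∀ x y z → x ℤ.* (y ℤ.* z) ≡ y ℤ.* (x ℤ.* z)
    left-comm = ℤ-Solver.solve-∀

-- Rational weights and Markov chains

open import Data.Rational.Base using (_+_; _*_; _÷_; _/_; 1/_)
open Σℚ

-- Since `_/_` reduces fractions, identities between them are checked on unnormalised fractions, by
-- cross multiplication, and carried over.
fromℚᵘ-homo-* : ∀ p q → fromℚᵘ p * fromℚᵘ q ≡ fromℚᵘ (p ℚᵘ.* q)
fromℚᵘ-homo-* p q = ℚ.toℚᵘ-injective (begin-equality
  toℚᵘ (fromℚᵘ p * fromℚᵘ q)             ≃⟨ ℚ.toℚᵘ-homo-* (fromℚᵘ p) (fromℚᵘ q) ⟩
  toℚᵘ (fromℚᵘ p) ℚᵘ.* toℚᵘ (fromℚᵘ q)   ≃⟨ ℚᵘ.*-cong (ℚ.toℚᵘ-fromℚᵘ p) (ℚ.toℚᵘ-fromℚᵘ q) ⟩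
  p ℚᵘ.* q                               ≃⟨ ℚ.toℚᵘ-fromℚᵘ (p ℚᵘ.* q) ⟨
  toℚᵘ (fromℚᵘ (p ℚᵘ.* q))               ∎)
  where open ℚᵘ.≤-Reasoning

fromℚᵘ-homo-+ : ∀ p q → fromℚᵘ p + fromℚᵘ q ≡ fromℚᵘ (p ℚᵘ.+ q)
fromℚᵘ-homo-+ p q = ℚ.toℚᵘ-injective (begin-equality
  toℚᵘ (fromℚᵘ p + fromℚᵘ q)             ≃⟨ ℚ.toℚᵘ-homo-+ (fromℚᵘ p) (fromℚᵘ q) ⟩
  toℚᵘ (fromℚᵘ p) ℚᵘ.+ toℚᵘ (fromℚᵘ q)   ≃⟨ ℚᵘ.+-cong (ℚ.toℚᵘ-fromℚᵘ p) (ℚ.toℚᵘ-fromℚᵘ q) ⟩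
  p ℚᵘ.+ q                               ≃⟨ ℚ.toℚᵘ-fromℚᵘ (p ℚᵘ.+ q) ⟨
  toℚᵘ (fromℚᵘ (p ℚᵘ.+ q))               ∎)
  where open ℚᵘ.≤-Reasoning

ι : ℕ → ℚ
ι k = + k / 1

reciprocal : ∀ k .{{_ : NonZero k}} → ℚ
reciprocal k = + 1 / k

/-reciprocal : ∀ k l .{{_ : NonZero l}} → + k / l ≡ ι k * reciprocal l
/-reciprocal k (suc l) = sym (trans (fromℚᵘ-homo-* p q)
  (ℚ.fromℚᵘ-cong {p ℚᵘ.* q} {ℚᵘ.mkℚᵘ (+ k) l}
    (ℚᵘ.*≡* (cong₂ ℤ._*_ (ℤ.*-identityʳ (+ k)) (sym (ℤ.*-identityˡ (+ suc l)))))))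
  where
  p = ℚᵘ.mkℚᵘ (+ k) 0
  q = ℚᵘ.mkℚᵘ (+ 1) l

ι-+ : ∀ k l → ι (k ℕ.+ l) ≡ ι k + ι l
ι-+ k l = sym (trans (fromℚᵘ-homo-+ p q)
  (ℚ.fromℚᵘ-cong {p ℚᵘ.+ q} {ℚᵘ.mkℚᵘ (+ (k ℕ.+ l)) 0}
    (ℚᵘ.*≡* (cong (ℤ._* + 1) (cong₂ ℤ._+_ (ℤ.*-identityʳ (+ k)) (ℤ.*-identityʳ (+ l)))))))
  where
  p = ℚᵘ.mkℚᵘ (+ k) 0
  q = ℚᵘ.mkℚᵘ (+ l) 0

reciprocal-* : ∀ k l .{{_ : NonZero k}} .{{_ : NonZero l}} .{{_ : NonZero (k ℕ.* l)}} →
               reciprocal (k ℕ.* l) ≡ reciprocal k * reciprocal l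
reciprocal-* (suc k) (suc l) = sym (fromℚᵘ-homo-* (ℚᵘ.mkℚᵘ (+ 1) k) (ℚᵘ.mkℚᵘ (+ 1) l))

ι*reciprocal : ∀ k .{{_ : NonZero k}} → ι k * reciprocal k ≡ 1ℚ
ι*reciprocal (suc k) = trans (sym (/-reciprocal (suc k) (suc k)))
  (ℚ.fromℚᵘ-cong {ℚᵘ.mkℚᵘ (+ suc k) k} {ℚᵘ.1ℚᵘ} (ℚᵘ.*≡* (ℤ.*-comm (+ suc k) (+ 1))))

/-nonNegative : ∀ k l .{{_ : NonZero l}} → 0ℚ ℚ.≤ + k / l
/-nonNegative k l = ℚ.nonNegative⁻¹ (+ k / l) {{ℚ.normalize-nonNeg k l}}

opaque
  unfolding BigSum.∑

  ι-∑ : ∀ (xs : List A) f → ι (Σℕ.∑ xs f) ≡ ∑ xs (ι ∘ f)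
  ι-∑ []       f = refl
  ι-∑ (x ∷ xs) f = trans (ι-+ (f x) _) (cong (_+_ (ι (f x))) (ι-∑ xs f))

ι-*-⟦⟧ : ∀ {P : Set} k (P? : Dec P) → ι (k ℕ.* Σℕ.⟦ P? ⟧) ≡ ι k * ⟦ P? ⟧
ι-*-⟦⟧ k (yes _) = trans (cong ι (ℕ.*-identityʳ k)) (sym (ℚ.*-identityʳ (ι k)))
ι-*-⟦⟧ k (no _)  = trans (cong ι (ℕ.*-zeroʳ k)) (sym (ℚ.*-zeroʳ (ι k)))

sum-∑ : ∀ n (f : Fin n → ℚ) → sum f ≡ ∑ (allFin n) f
sum-∑ zero    f = sym ∑-[]
sum-∑ (suc n) f = trans (cong (_+_ (f zero)) (sum-∑ n (f ∘ suc))) (sym (∑-allFin-suc n f))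

Pr-∑ : (L : Law A) {P : Pred A 0ℓ} (P? : Decidable P) →
       Pr L P? ≡ ∑ (outcomes L) (λ x → ⟦ P? x ⟧ * mass L x)
Pr-∑ L P? = trans (sym (∑-foldr _ (mass L))) (∑-filter P? (outcomes L) (mass L))

-- Processes driven by independent inputs

pathWeight : Matrix n → ∀ {r} → Vec (Fin n) (suc r) → ℚ
pathWeight K (i ∷ [])    = 1ℚ
pathWeight K (i ∷ j ∷ p) = K i j * pathWeight K (j ∷ p)

-- Paths unfold from the front, following the inputs, whereas the Markov property adds a state at
-- the end.
pathWeight-∷ʳ : ∀ (K : Matrix n) {r} (p : Vec (Fin n) (suc r)) j →
                pathWeight K (p ∷ʳ j) ≡ pathWeight K p * K (last p) j
pathWeight-∷ʳ K (i ∷ [])    j = trans (ℚ.*-identityʳ (K i j)) (sym (ℚ.*-identityˡ (K i j)))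
pathWeight-∷ʳ K (i ∷ k ∷ p) j =
  trans (cong (K i k *_) (pathWeight-∷ʳ K (k ∷ p) j)) (sym (ℚ.*-assoc (K i k) _ _))

*-left-comm : ∀ p q r → p * (q * r) ≡ q * (p * r)
*-left-comm p q r = trans (sym (ℚ.*-assoc p q r)) (trans (cong (_* r) (ℚ.*-comm p q)) (ℚ.*-assoc q p r))

⟦⟧-idem : ∀ {P : Set} (P? : Dec P) p → ⟦ P? ⟧ * (⟦ P? ⟧ * p) ≡ ⟦ P? ⟧ * p
⟦⟧-idem P? p = ⟦⟧-⊗-cong P? λ x → trans (cong (_* p) (⟦⟧-true P? x)) (ℚ.*-identityˡ p)

module _ {n} (L : Law A) (step : S → A → S) (obs : S → Fin n) where

  private
    X : S → Process n
    X s = driven L step s obs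

  driven-zero : ∀ s i → X s 0 (i ∷ []) ≡ ⟦ obs s Fin.≟ i ⟧
  driven-zero s i = begin
    X s 0 (i ∷ [])
      ≡⟨ Pr-∑ (iid 0 L) (λ xs → Vec.≡-dec Fin._≟_ (Vec.map obs (trajectory step s xs)) (i ∷ [])) ⟩
    ∑ ([] ∷ []) (λ xs → ⟦ Vec.≡-dec Fin._≟_ (Vec.map obs (trajectory step s xs)) (i ∷ []) ⟧ * _)
      ≡⟨ ∑-singleton ⟩
    ⟦ Vec.≡-dec Fin._≟_ (obs s ∷ []) (i ∷ []) ⟧ * 1ℚ
      ≡⟨ ℚ.*-identityʳ _ ⟩
    ⟦ Vec.≡-dec Fin._≟_ (obs s ∷ []) (i ∷ []) ⟧
      ≡⟨ ⟦⟧-cong (Vec.≡-dec Fin._≟_ (obs s ∷ []) (i ∷ [])) (obs s Fin.≟ i) Vec.∷-injectiveˡ (cong (_∷ [])) ⟩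
    ⟦ obs s Fin.≟ i ⟧ ∎
    where open ≡-Reasoning

  -- First-step analysis: the mass of a tuple is a product, and after the first input the rest is
  -- the same process started at `step s x`.
  driven-suc : ∀ s r i p → X s (suc r) (i ∷ p) ≡
               ⟦ obs s Fin.≟ i ⟧ * ∑ (outcomes L) (λ x → mass L x * X (step s x) r p)
  driven-suc s r i p = begin
    X s (suc r) (i ∷ p)
      ≡⟨ Pr-∑ (iid (suc r) L) (λ xs → Vec.≡-dec Fin._≟_ (Vec.map obs (trajectory step s xs)) (i ∷ p)) ⟩
    ∑ (tuples (suc r) (outcomes L)) (λ xs →
        ⟦ Vec.≡-dec Fin._≟_ (Vec.map obs (trajectory step s xs)) (i ∷ p) ⟧ * mass (iid (suc r) L) xs)
      ≡⟨ ∑-cartesianProductWith _∷_ (outcomes L) T _ ⟩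
    ∑ (outcomes L) (λ x → ∑ T λ xs →
        ⟦ Vec.≡-dec Fin._≟_ (obs s ∷ Vec.map obs (trajectory step (step s x) xs)) (i ∷ p) ⟧
          * (mass L x * mass (iid r L) xs))
      ≡⟨ ∑-cong (outcomes L) (λ x → ∑-cong T λ xs → trans
           (cong (_* (mass L x * mass (iid r L) xs)) (⟦⟧-×-dec (obs s Fin.≟ i) (next? x xs)))
           (regroup ⟦ obs s Fin.≟ i ⟧ ⟦ next? x xs ⟧ (mass L x) _)) ⟩
    ∑ (outcomes L) (λ x → ∑ T λ xs → ⟦ obs s Fin.≟ i ⟧ * (mass L x * (⟦ next? x xs ⟧ * mass (iid r L) xs)))
      ≡⟨ ∑-cong (outcomes L) (λ x → trans (sym (⊗-∑ ⟦ obs s Fin.≟ i ⟧ T _))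
           (cong (⟦ obs s Fin.≟ i ⟧ *_) (sym (⊗-∑ (mass L x) T _)))) ⟩
    ∑ (outcomes L) (λ x → ⟦ obs s Fin.≟ i ⟧ * (mass L x * ∑ T λ xs → ⟦ next? x xs ⟧ * mass (iid r L) xs))
      ≡⟨ ⊗-∑ ⟦ obs s Fin.≟ i ⟧ (outcomes L) _ ⟨
    ⟦ obs s Fin.≟ i ⟧ * ∑ (outcomes L) (λ x → mass L x * ∑ T λ xs → ⟦ next? x xs ⟧ * mass (iid r L) xs)
      ≡⟨ cong (⟦ obs s Fin.≟ i ⟧ *_) (∑-cong (outcomes L) λ x → cong (mass L x *_) (Pr-∑ (iid r L) (next? x))) ⟨
    ⟦ obs s Fin.≟ i ⟧ * ∑ (outcomes L) (λ x → mass L x * X (step s x) r p) ∎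
    where
    open ≡-Reasoning
    T = tuples r (outcomes L)
    next? = λ x xs → Vec.≡-dec Fin._≟_ (Vec.map obs (trajectory step (step s x) xs)) p
    regroup : ∀ a b c e → (a * b) * (c * e) ≡ a * (c * (b * e))
    regroup a b c e = trans (ℚ.*-assoc a b (c * e)) (cong (a *_) (*-left-comm b c e))

  driven-obs : ∀ s r i p → ⟦ obs s Fin.≟ i ⟧ * X s r (i ∷ p) ≡ X s r (i ∷ p)
  driven-obs s zero    i [] = subst (λ q → ⟦ obs s Fin.≟ i ⟧ * q ≡ q)
    (sym (trans (driven-zero s i) (sym (ℚ.*-identityʳ _)))) (⟦⟧-idem (obs s Fin.≟ i) 1ℚ)
  driven-obs s (suc r) i p  = subst (λ q → ⟦ obs s Fin.≟ i ⟧ * q ≡ q)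
    (sym (driven-suc s r i p)) (⟦⟧-idem (obs s Fin.≟ i) _)

  module _ {_~_ : S → S → Set} (obs-cong : ∀ s t → s ~ t → obs s ≡ obs t)
    (step-cong : ∀ s t x → s ~ t → step s x ~ step t x) where

    driven-cong : ∀ r p s t → s ~ t → X s r p ≡ X t r p
    driven-cong zero    (i ∷ []) s t s~t = begin
      X s 0 (i ∷ [])      ≡⟨ driven-zero s i ⟩
      ⟦ obs s Fin.≟ i ⟧   ≡⟨ cong (λ k → ⟦ k Fin.≟ i ⟧) (obs-cong s t s~t) ⟩
      ⟦ obs t Fin.≟ i ⟧   ≡⟨ driven-zero t i ⟨
      X t 0 (i ∷ [])      ∎
      where open ≡-Reasoning
    driven-cong (suc r) (i ∷ p)  s t s~t = begin
      X s (suc r) (i ∷ p)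
        ≡⟨ driven-suc s r i p ⟩
      ⟦ obs s Fin.≟ i ⟧ * ∑ (outcomes L) (λ x → mass L x * X (step s x) r p)
        ≡⟨ cong₂ (λ k q → ⟦ k Fin.≟ i ⟧ * q) (obs-cong s t s~t)
             (∑-cong (outcomes L) λ x → cong (mass L x *_) (driven-cong r p _ _ (step-cong s t x s~t))) ⟩
      ⟦ obs t Fin.≟ i ⟧ * ∑ (outcomes L) (λ x → mass L x * X (step t x) r p)
        ≡⟨ driven-suc t r i p ⟨
      X t (suc r) (i ∷ p) ∎
      where open ≡-Reasoning

    -- E i averages over the states observed as i.  The hypotheses say that the
    -- start is so distributed and that one step preserves this form, so it is
    -- the conditional law of the state given the whole observed past.
    module _ (start : S) (K : Matrix n) (E : Fin n → (S → ℚ) → ℚ)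
      (E-cong  : ∀ i {φ ψ} → (∀ s → φ s ≡ ψ s) → E i φ ≡ E i ψ)
      (E-one   : ∀ i → E i (λ _ → 1ℚ) ≡ 1ℚ)
      (E-obs   : ∀ i φ → E i (λ s → ⟦ obs s Fin.≟ i ⟧ * φ s) ≡ E i φ)
      (E-start : ∀ φ → (∀ s t → s ~ t → φ s ≡ φ t) → φ start ≡ E (obs start) φ)
      (E-step  : ∀ i j φ → (∀ s t → s ~ t → φ s ≡ φ t) →
                 E i (λ s → ∑ (outcomes L) λ x → mass L x * (⟦ obs (step s x) Fin.≟ j ⟧ * φ (step s x)))
                 ≡ K i j * E j φ)
      where

      -- `E-obs` absorbs the bracket of the first observation, and `E-step` trades one step for a
      -- factor `K i j` and the average over j. This is the intertwining criterion for a function of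
      -- a Markov chain to be Markov.
      E-driven : ∀ r i p → E i (λ s → X s r (i ∷ p)) ≡ pathWeight K (i ∷ p)
      E-driven zero    i []      = begin
        E i (λ s → X s 0 (i ∷ []))
          ≡⟨ E-cong i (λ s → trans (driven-zero s i) (sym (ℚ.*-identityʳ _))) ⟩
        E i (λ s → ⟦ obs s Fin.≟ i ⟧ * 1ℚ)  ≡⟨ E-obs i (λ _ → 1ℚ) ⟩
        E i (λ _ → 1ℚ)                      ≡⟨ E-one i ⟩
        1ℚ                                  ∎
        where open ≡-Reasoning
      E-driven (suc r) i (j ∷ p) = begin
        E i (λ s → X s (suc r) (i ∷ j ∷ p))
          ≡⟨ E-cong i (λ s → driven-suc s r i (j ∷ p)) ⟩
        E i (λ s → ⟦ obs s Fin.≟ i ⟧ * ∑ (outcomes L) λ x → mass L x * X (step s x) r (j ∷ p))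
          ≡⟨ E-obs i _ ⟩
        E i (λ s → ∑ (outcomes L) λ x → mass L x * X (step s x) r (j ∷ p))
          ≡⟨ E-cong i (λ s → ∑-cong (outcomes L) λ x → cong (mass L x *_) (driven-obs (step s x) r j p)) ⟨
        E i (λ s → ∑ (outcomes L) λ x → mass L x * (⟦ obs (step s x) Fin.≟ j ⟧ * X (step s x) r (j ∷ p)))
          ≡⟨ E-step i j (λ s → X s r (j ∷ p)) (driven-cong r (j ∷ p)) ⟩
        K i j * E j (λ s → X s r (j ∷ p))
          ≡⟨ cong (K i j *_) (E-driven r j p) ⟩
        K i j * pathWeight K (j ∷ p) ∎
        where open ≡-Reasoning

      driven-pathWeight : ∀ r i p → X start r (i ∷ p) ≡ ⟦ obs start Fin.≟ i ⟧ * pathWeight K (i ∷ p)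
      driven-pathWeight r i p = trans (sym (driven-obs start r i p)) (⟦⟧-⊗-cong (obs start Fin.≟ i) λ o≡i →
        trans (E-start (λ s → X s r (i ∷ p)) (driven-cong r (i ∷ p)))
          (trans (cong (λ k → E k (λ s → X s r (i ∷ p))) o≡i) (E-driven r i p)))

      driven-isMarkovChain : (∀ i → IsDistribution (K i)) → IsMarkovChain (X start) K
      driven-isMarkovChain stochastic = record
        { stochastic = stochastic
        ; markov     = λ { r p@(i ∷ q) j → begin
            X start (suc r) (i ∷ (q ∷ʳ j))
              ≡⟨ driven-pathWeight (suc r) i (q ∷ʳ j) ⟩
            ⟦ obs start Fin.≟ i ⟧ * pathWeight K (p ∷ʳ j)
              ≡⟨ cong (⟦ obs start Fin.≟ i ⟧ *_) (pathWeight-∷ʳ K p j) ⟩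
            ⟦ obs start Fin.≟ i ⟧ * (pathWeight K p * K (last p) j)
              ≡⟨ ℚ.*-assoc ⟦ obs start Fin.≟ i ⟧ _ _ ⟨
            (⟦ obs start Fin.≟ i ⟧ * pathWeight K p) * K (last p) j
              ≡⟨ cong (_* K (last p) j) (driven-pathWeight r i q) ⟨
            X start r p * K (last p) j                                         ∎ }
        }
        where open ≡-Reasoning

-- Permutations without descents, sums over permutations, total masses

descents≡0⇒increasing : (x : Fin (suc n) → ℕ) → (∀ {i j} → x i ≡ x j → i ≡ j) →
                        ∣ descents x ∣ ≡ 0 → Increasing x
descents≡0⇒increasing {zero}  x inj _  = tt
descents≡0⇒increasing {suc n} x inj eq with x (suc zero) ℕ.<? x zero
... | yes lt with () ← trans
  (sym (cong (λ b → ∣ b Vec.∷ descents (x ∘ suc) ∣) (dec-true (x (suc zero) ℕ.<? x zero) lt))) eq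
... | no ¬lt = ℕ.≤∧≢⇒< (ℕ.≮⇒≥ ¬lt) (λ e → Fin.0≢1+n (inj e)) ,
  descents≡0⇒increasing (x ∘ suc) (Fin.suc-injective ∘ inj)
    (trans (sym (cong (λ b → ∣ b Vec.∷ descents (x ∘ suc) ∣) (dec-false (x (suc zero) ℕ.<? x zero) ¬lt))) eq)

increasing⇒descents≡0 : (x : Fin (suc n) → ℕ) → Increasing x → ∣ descents x ∣ ≡ 0
increasing⇒descents≡0 {zero}  x _           = refl
increasing⇒descents≡0 {suc n} x (lt , inc) = trans
  (cong (λ b → ∣ b Vec.∷ descents (x ∘ suc) ∣) (dec-false (x (suc zero) ℕ.<? x zero) (ℕ.<-asym lt)))
  (increasing⇒descents≡0 (x ∘ suc) inc)

d-cong : {σ τ : Permutation′ n} → σ Perm.≈ τ → d σ ≡ d τ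
d-cong {zero}  eq = refl
d-cong {suc m} eq = cong ∣_∣ (Vec.tabulate-cong λ i →
  cong₂ (λ k l → does (k Fin.<? l)) (eq (suc i)) (eq (inject₁ i)))

-- Makes the descent class of the initial arrangement a single point, so the deterministic start is
-- uniform on its class.
d≡0⇒id : (σ : Permutation′ n) → d σ ≡ 0 → σ Perm.≈ Perm.id
d≡0⇒id {suc m} σ eq = monotone⇒id σ (increasing⇒monotone (toℕ ∘ (σ ⟨$⟩ʳ_))
  (descents≡0⇒increasing _ (⟨$⟩ʳ-injective σ) eq))

d-id : d (Perm.id {n}) ≡ 0
d-id {zero}  = refl
d-id {suc m} = increasing⇒descents≡0 {m} toℕ (monotone⇒increasing {suc m} toℕ id)

flip-cong : {σ τ : Permutation′ n} → σ Perm.≈ τ → flip σ Perm.≈ flip τ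
flip-cong {σ = σ} {τ} eq i = begin
  σ ⟨$⟩ˡ i                    ≡⟨ cong (σ ⟨$⟩ˡ_) (inverseʳ τ) ⟨
  σ ⟨$⟩ˡ (τ ⟨$⟩ʳ (τ ⟨$⟩ˡ i))  ≡⟨ cong (σ ⟨$⟩ˡ_) (eq (τ ⟨$⟩ˡ i)) ⟨
  σ ⟨$⟩ˡ (σ ⟨$⟩ʳ (τ ⟨$⟩ˡ i))  ≡⟨ inverseˡ σ ⟩
  τ ⟨$⟩ˡ i                    ∎
  where open ≡-Reasoning

∑-perms-flip : ∀ n {f : Permutation′ n → ℚ} → (∀ σ τ → σ Perm.≈ τ → f σ ≡ f τ) →
               ∑ (perms n) (f ∘ flip) ≡ ∑ (perms n) f
∑-perms-flip n f-cong = ∑-reindex _≈?_ (perms-enumerate n) f-cong flip flip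
  (λ σ τ eq i → sym (flip-cong {σ = τ} {flip σ} eq i))
  (λ σ τ eq i → sym (flip-cong {σ = σ} {flip τ} eq i))

∑-fibres : ∀ (xs : List A) (φ : A → Fin n) f →
           ∑ (allFin n) (λ j → ∑ xs λ x → f x * ⟦ φ x Fin.≟ j ⟧) ≡ ∑ xs f
∑-fibres {n = n} xs φ f = begin
  ∑ (allFin n) (λ j → ∑ xs λ x → f x * ⟦ φ x Fin.≟ j ⟧)
    ≡⟨ ∑-swap (allFin n) xs _ ⟩
  ∑ xs (λ x → ∑ (allFin n) λ j → f x * ⟦ φ x Fin.≟ j ⟧)
    ≡⟨ ∑-cong xs (λ x → ⊗-∑ (f x) (allFin n) _) ⟨
  ∑ xs (λ x → f x * ∑ (allFin n) λ j → ⟦ φ x Fin.≟ j ⟧)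
    ≡⟨ ∑-cong xs (λ x → cong (f x *_) (trans
         (∑-cong (allFin n) λ j → ⟦⟧-cong (φ x Fin.≟ j) (j Fin.≟ φ x) sym sym)
         (allFin-enumerates n (φ x)))) ⟩
  ∑ xs (λ x → f x * 1ℚ)
    ≡⟨ ∑-cong xs (λ x → ℚ.*-identityʳ (f x)) ⟩
  ∑ xs f ∎
  where open ≡-Reasoning

opaque
  unfolding BigSum.∑

  length-filter : ∀ {P : Pred A 0ℓ} (P? : Decidable P) xs →
                  length (filter P? xs) ≡ Σℕ.∑ xs (λ x → Σℕ.⟦ P? x ⟧)
  length-filter P? []       = refl
  length-filter P? (x ∷ xs) with P? x
  ... | yes _ = cong suc (length-filter P? xs)
  ... | no  _ = length-filter P? xs

∑-allFin-const : ∀ n k → Σℕ.∑ (allFin n) (λ _ → k) ≡ n ℕ.* k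
∑-allFin-const zero    k = Σℕ.∑-[]
∑-allFin-const (suc n) k = trans (Σℕ.∑-allFin-suc n _) (cong (k ℕ.+_) (∑-allFin-const n k))

∑-perms-1 : ∀ n → Σℕ.∑ (perms n) (λ _ → 1) ≡ n !
∑-perms-1 zero    = Σℕ.∑-singleton
∑-perms-1 (suc n) = begin
  Σℕ.∑ (perms (suc n)) (λ _ → 1)
    ≡⟨ Σℕ.∑-cartesianProductWith (insert zero) (allFin (suc n)) (perms n) _ ⟩
  Σℕ.∑ (allFin (suc n)) (λ _ → Σℕ.∑ (perms n) (λ _ → 1))
    ≡⟨ ∑-allFin-const (suc n) _ ⟩
  suc n ℕ.* Σℕ.∑ (perms n) (λ _ → 1)
    ≡⟨ cong (suc n ℕ.*_) (∑-perms-1 n) ⟩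
  suc n ! ∎
  where open ≡-Reasoning

iid-total : (L : Law A) → ∑ (outcomes L) (mass L) ≡ 1ℚ →
            ∀ r → ∑ (outcomes (iid r L)) (mass (iid r L)) ≡ 1ℚ
iid-total L total zero    = ∑-singleton
iid-total L total (suc r) = begin
  ∑ (tuples (suc r) (outcomes L)) (mass (iid (suc r) L))
    ≡⟨ ∑-cartesianProductWith _∷_ (outcomes L) (tuples r (outcomes L)) _ ⟩
  ∑ (outcomes L) (λ x → ∑ (tuples r (outcomes L)) λ v → mass L x * mass (iid r L) v)
    ≡⟨ ∑-cong (outcomes L) (λ x → ⊗-∑ (mass L x) (tuples r (outcomes L)) _) ⟨
  ∑ (outcomes L) (λ x → mass L x * ∑ (tuples r (outcomes L)) (mass (iid r L)))
    ≡⟨ ∑-cong (outcomes L) (λ x → trans (cong (mass L x *_) (iid-total L total r)) (ℚ.*-identityʳ (mass L x))) ⟩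
  ∑ (outcomes L) (mass L)
    ≡⟨ total ⟩
  1ℚ ∎
  where open ≡-Reasoning

uniform-total : ∀ b .{{_ : NonZero b}} → ∑ (allFin b) (mass (uniform b)) ≡ 1ℚ
uniform-total b = begin
  ∑ (allFin b) (λ _ → reciprocal b)            ≡⟨ ∑-cong (allFin b) (λ _ → ℚ.*-identityˡ (reciprocal b)) ⟨
  ∑ (allFin b) (λ _ → 1ℚ * reciprocal b)       ≡⟨ ∑-⊗ (allFin b) _ (reciprocal b) ⟨
  ∑ (allFin b) (λ _ → 1ℚ) * reciprocal b       ≡⟨ cong (_* reciprocal b) (ι-∑ (allFin b) (λ _ → 1)) ⟨
  ι (Σℕ.∑ (allFin b) (λ _ → 1)) * reciprocal b
    ≡⟨ cong (λ k → ι k * reciprocal b) (trans (∑-allFin-const b 1) (ℕ.*-identityʳ b)) ⟩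
  ι b * reciprocal b                           ≡⟨ ι*reciprocal b ⟩
  1ℚ                                           ∎
  where open ≡-Reasoning

mass-iid-uniform : ∀ r b .{{_ : NonZero b}} x →
                   mass (iid r (uniform b)) x ≡ reciprocal (b ^ r) {{ℕ.m^n≢0 b r}}
mass-iid-uniform zero    b []      = refl
mass-iid-uniform (suc r) b {{b≢0}} (_ ∷ x) = trans (cong (reciprocal b *_) (mass-iid-uniform r b x))
  (sym (reciprocal-* b (b ^ r) {{b≢0}} {{ℕ.m^n≢0 b r}} {{ℕ.m^n≢0 b (suc r)}}))

-- The matrix P_b, from carries and from shuffles

module _ (m b : ℕ) .{{_ : NonZero b}} where

  private
    n′ : ℕ
    n′ = suc m

    instance
      bⁿ≢0 : NonZero (b ^ n′)
      bⁿ≢0 = ℕ.m^n≢0 b n′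

      n!≢0 : NonZero (n′ !)
      n!≢0 = n′ ℕ.!≢0

  -- The counts h determine row i of P_b. They are met in two ways: by columns of digits, with φ the
  -- new carry and w = 1, and by permutations, with φ = d and w the shuffle numerators. This common
  -- row is the link between the two chains.
  module _ {A : Set} (xs : List A) (φ w : A → ℕ) (i : Fin n′)
    (h : ∀ a → Σℕ.∑ xs (λ x → w x ℕ.* simplex n′ (a ∸ φ x)) ≡ simplex n′ (a ℕ.* b ∸ toℕ i)) (j : Fin n′) where

    P-count : P n′ b i j ≡ + Σℕ.∑ xs (λ x → w x ℕ.* Σℕ.⟦ φ x ℕ.≟ toℕ j ⟧) / b ^ n′
    P-count = cong (_/ b ^ n′) (sym (∑-≟-carryTerm b (ℕ.s≤s⁻¹ (Fin.toℕ<n i)) xs φ w h (toℕ j)))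

    -- An alternating sum shows no sign; the weighted count it equals does.
    P-nonNegative : 0ℚ ℚ.≤ P n′ b i j
    P-nonNegative = subst (0ℚ ℚ.≤_) (sym P-count)
      (/-nonNegative (Σℕ.∑ xs (λ x → w x ℕ.* Σℕ.⟦ φ x ℕ.≟ toℕ j ⟧)) (b ^ n′))

    P-∑ : P n′ b i j ≡ ∑ xs (λ x → (+ w x / b ^ n′) * ⟦ φ x ℕ.≟ toℕ j ⟧)
    P-∑ = begin
      P n′ b i j
        ≡⟨ P-count ⟩
      + Σℕ.∑ xs (λ x → w x ℕ.* Σℕ.⟦ φ x ℕ.≟ toℕ j ⟧) / b ^ n′
        ≡⟨ /-reciprocal (Σℕ.∑ xs (λ x → w x ℕ.* Σℕ.⟦ φ x ℕ.≟ toℕ j ⟧)) (b ^ n′) ⟩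
      ι (Σℕ.∑ xs (λ x → w x ℕ.* Σℕ.⟦ φ x ℕ.≟ toℕ j ⟧)) * β
        ≡⟨ cong (_* β) (trans (ι-∑ xs _) (∑-cong xs λ x → ι-*-⟦⟧ (w x) (φ x ℕ.≟ toℕ j))) ⟩
      ∑ xs (λ x → ι (w x) * ⟦ φ x ℕ.≟ toℕ j ⟧) * β
        ≡⟨ ∑-⊗ xs _ β ⟩
      ∑ xs (λ x → ι (w x) * ⟦ φ x ℕ.≟ toℕ j ⟧ * β)
        ≡⟨ ∑-cong xs (λ x → trans (swap (ι (w x)) ⟦ φ x ℕ.≟ toℕ j ⟧ β)
             (cong (_* ⟦ φ x ℕ.≟ toℕ j ⟧) (sym (/-reciprocal (w x) (b ^ n′))))) ⟩
      ∑ xs (λ x → (+ w x / b ^ n′) * ⟦ φ x ℕ.≟ toℕ j ⟧) ∎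
      where
      open ≡-Reasoning
      β = reciprocal (b ^ n′)
      swap : ∀ p q r → p * q * r ≡ p * r * q
      swap p q r = trans (ℚ.*-assoc p q r) (trans (cong (p *_) (ℚ.*-comm q r)) (sym (ℚ.*-assoc p r q)))

  private
    digits : Law (Vec (Fin b) n′)
    digits = iid n′ (uniform b)

    carry-simplex : ∀ (i : Fin n′) a →
      Σℕ.∑ (outcomes digits) (λ x → 1 ℕ.* simplex n′ (a ∸ (toℕ i ℕ.+ digitSum x) ℕ./ b))
      ≡ simplex n′ (a ℕ.* b ∸ toℕ i)
    carry-simplex i a = trans (Σℕ.∑-cong (outcomes digits) λ x → ℕ.*-identityˡ _) (∑-digits n′ a b (toℕ i))

  P-carries : ∀ i j → P n′ b i j ≡ ∑ (outcomes digits) (λ x → mass digits x * ⟦ addColumn i x Fin.≟ j ⟧)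
  P-carries i j = trans
    (P-∑ (outcomes digits) (λ x → (toℕ i ℕ.+ digitSum x) ℕ./ b) (λ _ → 1) i (carry-simplex i) j)
    (∑-cong (outcomes digits) λ x → cong₂ _*_ (sym (mass-iid-uniform n′ b x))
      (⟦⟧-cong (_ ℕ.≟ toℕ j) (addColumn i x Fin.≟ j)
        (λ eq → Fin.toℕ-injective (trans (Fin.toℕ-fromℕ< _) eq))
        (λ eq → trans (sym (Fin.toℕ-fromℕ< _)) (cong toℕ eq))))

  P-stochastic : ∀ i → IsDistribution (P n′ b i)
  P-stochastic i = record
    { nonNegative = P-nonNegative (outcomes digits) (λ x → (toℕ i ℕ.+ digitSum x) ℕ./ b) (λ _ → 1) i (carry-simplex i)
    ; total = begin
        sum (P n′ b i)
          ≡⟨ sum-∑ n′ (P n′ b i) ⟩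
        ∑ (allFin n′) (P n′ b i)
          ≡⟨ ∑-cong (allFin n′) (P-carries i) ⟩
        ∑ (allFin n′) (λ j → ∑ (outcomes digits) λ x → mass digits x * ⟦ addColumn i x Fin.≟ j ⟧)
          ≡⟨ ∑-fibres (outcomes digits) (addColumn i) (mass digits) ⟩
        ∑ (outcomes digits) (mass digits)
          ≡⟨ iid-total (uniform b) (uniform-total b) n′ ⟩
        1ℚ ∎
    }
    where open ≡-Reasoning

  carries-isMarkovChain : IsMarkovChain (carries n′ b) (P n′ b)
  -- The carry is itself the state, so the average over the states observed as i is evaluation at i.
  carries-isMarkovChain = driven-isMarkovChain digits addColumn (λ κ → κ) {_~_ = _≡_} (λ _ _ eq → eq)
    (λ _ _ x → cong (λ κ → addColumn κ x)) zero (P n′ b) (λ i φ → φ i)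
    (λ i eq → eq i) (λ i → refl)
    (λ i φ → trans (cong (_* φ i) (⟦⟧-true (i Fin.≟ i) refl)) (ℚ.*-identityˡ (φ i)))
    (λ φ _ → refl) step P-stochastic
    where
    step : ∀ i j φ → _ → ∑ (outcomes digits) (λ x → mass digits x * (⟦ addColumn i x Fin.≟ j ⟧ * φ (addColumn i x)))
                         ≡ P n′ b i j * φ j
    step i j φ _ = begin
      ∑ (outcomes digits) (λ x → mass digits x * (⟦ addColumn i x Fin.≟ j ⟧ * φ (addColumn i x)))
        ≡⟨ ∑-cong (outcomes digits) (λ x → trans
             (cong (mass digits x *_) (⟦⟧-⊗-cong (addColumn i x Fin.≟ j) (cong φ)))
             (sym (ℚ.*-assoc (mass digits x) _ (φ j)))) ⟩
      ∑ (outcomes digits) (λ x → mass digits x * ⟦ addColumn i x Fin.≟ j ⟧ * φ j)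
        ≡⟨ ∑-⊗ (outcomes digits) _ (φ j) ⟨
      ∑ (outcomes digits) (λ x → mass digits x * ⟦ addColumn i x Fin.≟ j ⟧) * φ j
        ≡⟨ cong (_* φ j) (P-carries i j) ⟨
      P n′ b i j * φ j ∎
      where open ≡-Reasoning

  private
    Sₙ : List (Permutation′ n′)
    Sₙ = perms n′

    descentsOf⁻¹ : Permutation′ n′ → Fin n′
    descentsOf⁻¹ τ = fromℕ< (d<n (flip τ))

    descentsOf⁻¹-cong : ∀ {σ τ} → σ Perm.≈ τ → descentsOf⁻¹ σ ≡ descentsOf⁻¹ τ
    descentsOf⁻¹-cong {σ} {τ} eq = Fin.fromℕ<-cong _ _ (d-cong {σ = flip σ} {flip τ} (flip-cong {σ = σ} {τ} eq)) _ _

    ⟦descentsOf⁻¹⟧ : ∀ τ i → ⟦ descentsOf⁻¹ τ Fin.≟ i ⟧ ≡ ⟦ d (flip τ) ℕ.≟ toℕ i ⟧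
    ⟦descentsOf⁻¹⟧ τ i = ⟦⟧-cong (descentsOf⁻¹ τ Fin.≟ i) (d (flip τ) ℕ.≟ toℕ i)
      (λ eq → trans (sym (Fin.toℕ-fromℕ< _)) (cong toℕ eq))
      (λ eq → Fin.toℕ-injective (trans (Fin.toℕ-fromℕ< _) eq))

    shuffleMass : ℕ → ℚ
    shuffleMass e = + simplex n′ (b ∸ e) / b ^ n′

    Q-simplex : ∀ σ → Q n′ b σ ≡ shuffleMass (d (flip σ))
    Q-simplex σ = cong (λ k → + k / b ^ n′) (trans (cong (_C n′) top) (simplex-∸-C b e≤m))
      where
      e = d (flip σ)
      e≤m : e ℕ.≤ m
      e≤m = ℕ.s≤s⁻¹ (d<n (flip σ))
      top : n′ ℕ.+ b ∸ e ∸ 1 ≡ m ∸ e ℕ.+ b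
      top = begin
        n′ ℕ.+ b ∸ e ∸ 1     ≡⟨ ℕ.∸-+-assoc (n′ ℕ.+ b) e 1 ⟩
        n′ ℕ.+ b ∸ (e ℕ.+ 1) ≡⟨ cong (n′ ℕ.+ b ∸_) (ℕ.+-comm e 1) ⟩
        m ℕ.+ b ∸ e          ≡⟨ ℕ.+-∸-comm b e≤m ⟩
        m ∸ e ℕ.+ b          ∎
        where open ≡-Reasoning

    Q-cong : ∀ {σ τ} → σ Perm.≈ τ → Q n′ b σ ≡ Q n′ b τ
    Q-cong {σ} {τ} eq = trans (Q-simplex σ) (trans
      (cong shuffleMass (d-cong {σ = flip σ} {flip τ} (flip-cong {σ = σ} {τ} eq))) (sym (Q-simplex τ)))

    -- `t ∘ₚ flip s` is s⁻¹ t, the shuffle leading from s to t. Its inverse t⁻¹ s is x σ⁻¹ for x =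
    -- t⁻¹ and σ = s⁻¹, as in `∑-perms-simplex`.
    Q-flip : ∀ (s t : Permutation′ n′) → Q n′ b (t ∘ₚ flip s) ≡ shuffleMass (d (s ∘ₚ flip t))
    Q-flip s t = trans (Q-simplex (t ∘ₚ flip s))
      (cong shuffleMass (d-cong {σ = flip (t ∘ₚ flip s)} {s ∘ₚ flip t} λ _ → refl))

  P-shuffles : ∀ t i → P n′ b (descentsOf⁻¹ t) i
               ≡ ∑ Sₙ (λ s → Q n′ b (t ∘ₚ flip s) * ⟦ descentsOf⁻¹ s Fin.≟ i ⟧)
  P-shuffles t i = begin
    P n′ b (descentsOf⁻¹ t) i
      ≡⟨ P-∑ Sₙ d (λ σ → simplex n′ (b ∸ d (flip σ ∘ₚ flip t))) (descentsOf⁻¹ t) (λ a → trans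
           (∑-perms-simplex a b (flip t))
           (cong (λ e → simplex n′ (a ℕ.* b ∸ e)) (sym (Fin.toℕ-fromℕ< (d<n (flip t)))))) i ⟩
    ∑ Sₙ f
      ≡⟨ ∑-perms-flip n′ f-cong ⟨
    ∑ Sₙ (λ s → shuffleMass (d (flip (flip s) ∘ₚ flip t)) * ⟦ d (flip s) ℕ.≟ toℕ i ⟧)
      ≡⟨ ∑-cong Sₙ (λ s → cong₂ _*_
           (trans (Q-flip s t) (cong shuffleMass (d-cong {σ = s ∘ₚ flip t} {flip (flip s) ∘ₚ flip t} λ _ → refl)))
           (⟦descentsOf⁻¹⟧ s i)) ⟨
    ∑ Sₙ (λ s → Q n′ b (t ∘ₚ flip s) * ⟦ descentsOf⁻¹ s Fin.≟ i ⟧) ∎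
    where
    open ≡-Reasoning
    f : Permutation′ n′ → ℚ
    f σ = shuffleMass (d (flip σ ∘ₚ flip t)) * ⟦ d σ ℕ.≟ toℕ i ⟧
    f-cong : ∀ σ τ → σ Perm.≈ τ → f σ ≡ f τ
    f-cong σ τ eq = cong₂ (λ k l → shuffleMass k * ⟦ l ℕ.≟ toℕ i ⟧)
      (d-cong {σ = flip σ ∘ₚ flip t} {flip τ ∘ₚ flip t} (λ k → cong (t ⟨$⟩ˡ_) (flip-cong {σ = σ} {τ} eq k)))
      (d-cong {σ = σ} {τ} eq)

  private
    -- Sorting the permutations by descents of the inverse turns the total into the row of P_b at t
    -- = id, and that row sums to one because it is the law of a carry.
    Q-total : ∑ Sₙ (Q n′ b) ≡ 1ℚ
    Q-total = begin
      ∑ Sₙ (Q n′ b)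
        ≡⟨ ∑-perms-flip n′ (λ σ τ → Q-cong {σ} {τ}) ⟨
      ∑ Sₙ (λ s → Q n′ b (flip s))
        ≡⟨ ∑-cong Sₙ (λ s → Q-cong {flip s} {Perm.id ∘ₚ flip s} λ _ → refl) ⟩
      ∑ Sₙ (λ s → Q n′ b (Perm.id ∘ₚ flip s))
        ≡⟨ ∑-fibres Sₙ descentsOf⁻¹ _ ⟨
      ∑ (allFin n′) (λ i → ∑ Sₙ λ s → Q n′ b (Perm.id ∘ₚ flip s) * ⟦ descentsOf⁻¹ s Fin.≟ i ⟧)
        ≡⟨ ∑-cong (allFin n′) (P-shuffles Perm.id) ⟨
      ∑ (allFin n′) (P n′ b (descentsOf⁻¹ Perm.id))
        ≡⟨ sum-∑ n′ _ ⟨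
      sum (P n′ b (descentsOf⁻¹ Perm.id))
        ≡⟨ IsDistribution.total (P-stochastic (descentsOf⁻¹ Perm.id)) ⟩
      1ℚ ∎
      where open ≡-Reasoning

    ∑-translate : ∀ s {f : Permutation′ n′ → ℚ} → (∀ σ τ → σ Perm.≈ τ → f σ ≡ f τ) →
                  ∑ Sₙ (λ μ → f (μ ∘ₚ s)) ≡ ∑ Sₙ f
    ∑-translate s f-cong = ∑-reindex _≈?_ (perms-enumerate n′) f-cong (_∘ₚ s) (_∘ₚ flip s)
      (λ μ t eq i → trans (sym (inverseˡ s)) (cong (s ⟨$⟩ˡ_) (sym (eq i))))
      (λ μ t eq i → trans (sym (inverseʳ s)) (cong (s ⟨$⟩ʳ_) (sym (eq i))))

    ω : ℚ
    ω = reciprocal (n′ !)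

    π-∑ : ∀ i → π n′ i ≡ ω * ∑ Sₙ (λ τ → ⟦ descentsOf⁻¹ τ Fin.≟ i ⟧)
    π-∑ i = begin
      π n′ i
        ≡⟨ /-reciprocal (eulerian n′ (toℕ i)) (n′ !) ⟩
      ι (eulerian n′ (toℕ i)) * ω
        ≡⟨ ℚ.*-comm _ ω ⟩
      ω * ι (eulerian n′ (toℕ i))
        ≡⟨ cong (λ k → ω * ι k) (length-filter (λ σ → d σ ℕ.≟ toℕ i) Sₙ) ⟩
      ω * ι (Σℕ.∑ Sₙ (λ σ → Σℕ.⟦ d σ ℕ.≟ toℕ i ⟧))
        ≡⟨ cong (ω *_) (trans (ι-∑ Sₙ _) (∑-cong Sₙ λ σ → ι-⟦⟧ (d σ ℕ.≟ toℕ i))) ⟩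
      ω * ∑ Sₙ (λ σ → ⟦ d σ ℕ.≟ toℕ i ⟧)
        ≡⟨ cong (ω *_) (∑-perms-flip n′ λ σ τ eq → cong (λ k → ⟦ k ℕ.≟ toℕ i ⟧) (d-cong {σ = σ} {τ} eq)) ⟨
      ω * ∑ Sₙ (λ τ → ⟦ d (flip τ) ℕ.≟ toℕ i ⟧)
        ≡⟨ cong (ω *_) (∑-cong Sₙ λ τ → ⟦descentsOf⁻¹⟧ τ i) ⟨
      ω * ∑ Sₙ (λ τ → ⟦ descentsOf⁻¹ τ Fin.≟ i ⟧) ∎
      where
      open ≡-Reasoning
      ι-⟦⟧ : ∀ {P : Set} (P? : Dec P) → ι Σℕ.⟦ P? ⟧ ≡ ⟦ P? ⟧
      ι-⟦⟧ (yes _) = refl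
      ι-⟦⟧ (no _)  = refl

    -- π is the law of d(τ⁻¹) for a uniformly random τ.
    ∑-π : ∀ (f : Fin n′ → ℚ) → ∑ (allFin n′) (λ j → π n′ j * f j) ≡ ω * ∑ Sₙ (λ t → f (descentsOf⁻¹ t))
    ∑-π f = begin
      ∑ (allFin n′) (λ j → π n′ j * f j)
        ≡⟨ ∑-cong (allFin n′) (λ j → trans (cong (_* f j) (π-∑ j)) (trans (ℚ.*-assoc ω _ (f j))
             (cong (ω *_) (trans (∑-⊗ Sₙ _ (f j)) (∑-cong Sₙ λ t → trans
               (⟦⟧-⊗-cong (descentsOf⁻¹ t Fin.≟ j) (λ eq → cong f (sym eq)))
               (ℚ.*-comm _ (f (descentsOf⁻¹ t)))))))) ⟩
      ∑ (allFin n′) (λ j → ω * ∑ Sₙ λ t → f (descentsOf⁻¹ t) * ⟦ descentsOf⁻¹ t Fin.≟ j ⟧)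
        ≡⟨ ⊗-∑ ω (allFin n′) _ ⟨
      ω * ∑ (allFin n′) (λ j → ∑ Sₙ λ t → f (descentsOf⁻¹ t) * ⟦ descentsOf⁻¹ t Fin.≟ j ⟧)
        ≡⟨ cong (ω *_) (∑-fibres Sₙ descentsOf⁻¹ (f ∘ descentsOf⁻¹)) ⟩
      ω * ∑ Sₙ (λ t → f (descentsOf⁻¹ t)) ∎
      where open ≡-Reasoning

  -- The Eulerian distribution and the reversed matrix

  π-isDistribution : IsDistribution (π n′)
  π-isDistribution = record
    { nonNegative = λ i → /-nonNegative (eulerian n′ (toℕ i)) (n′ !)
    ; total = begin
        sum (π n′)                          ≡⟨ sum-∑ n′ (π n′) ⟩
        ∑ (allFin n′) (π n′)                ≡⟨ ∑-cong (allFin n′) (λ j → ℚ.*-identityʳ (π n′ j)) ⟨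
        ∑ (allFin n′) (λ j → π n′ j * 1ℚ)   ≡⟨ ∑-π (λ _ → 1ℚ) ⟩
        ω * ∑ Sₙ (λ _ → 1ℚ)                 ≡⟨ cong (ω *_) (ι-∑ Sₙ (λ _ → 1)) ⟨
        ω * ι (Σℕ.∑ Sₙ (λ _ → 1))           ≡⟨ cong (λ k → ω * ι k) (∑-perms-1 n′) ⟩
        ω * ι (n′ !)                        ≡⟨ ℚ.*-comm ω _ ⟩
        ι (n′ !) * ω                        ≡⟨ ι*reciprocal (n′ !) ⟩
        1ℚ                                  ∎
    }
    where open ≡-Reasoning

  -- The uniform law on permutations is invariant under shuffling: for fixed s, the masses of s⁻¹ t
  -- over all t are those of Q_b, translated, and add up to one.
  π-invariant-P : ∀ i → ∑ (allFin n′) (λ j → π n′ j * P n′ b j i) ≡ π n′ i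
  π-invariant-P i = begin
    ∑ (allFin n′) (λ j → π n′ j * P n′ b j i)
      ≡⟨ ∑-π (λ j → P n′ b j i) ⟩
    ω * ∑ Sₙ (λ t → P n′ b (descentsOf⁻¹ t) i)
      ≡⟨ cong (ω *_) (trans (∑-cong Sₙ λ t → P-shuffles t i) (∑-swap Sₙ Sₙ _)) ⟩
    ω * ∑ Sₙ (λ s → ∑ Sₙ λ t → Q n′ b (t ∘ₚ flip s) * ⟦ descentsOf⁻¹ s Fin.≟ i ⟧)
      ≡⟨ cong (ω *_) (∑-cong Sₙ λ s → trans (sym (∑-⊗ Sₙ _ _)) (trans
           (cong (_* ⟦ descentsOf⁻¹ s Fin.≟ i ⟧) (trans (∑-translate (flip s) (λ σ τ → Q-cong {σ} {τ})) Q-total))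
           (ℚ.*-identityˡ _))) ⟩
    ω * ∑ Sₙ (λ s → ⟦ descentsOf⁻¹ s Fin.≟ i ⟧)
      ≡⟨ π-∑ i ⟨
    π n′ i ∎
    where open ≡-Reasoning

  private
    π⁻¹ : Fin n′ → ℚ
    π⁻¹ i = (1/ π n′ i) {{π-nonZero i}}

    π*π⁻¹ : ∀ i → π n′ i * π⁻¹ i ≡ 1ℚ
    π*π⁻¹ i = ℚ.*-inverseʳ (π n′ i) {{π-nonZero i}}

  -- Taken to be the reversal formula itself, so that the whole content of the theorem lies in the
  -- Markov property.
  K : Matrix n′
  K i j = ((π n′ j * P n′ b j i) ÷ π n′ i) {{π-nonZero i}}

  π*K : ∀ i j → π n′ i * K i j ≡ π n′ j * P n′ b j i
  π*K i j = begin
    π n′ i * (π n′ j * P n′ b j i * π⁻¹ i)   ≡⟨ *-left-comm (π n′ i) (π n′ j * P n′ b j i) (π⁻¹ i) ⟩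
    π n′ j * P n′ b j i * (π n′ i * π⁻¹ i)   ≡⟨ cong (π n′ j * P n′ b j i *_) (π*π⁻¹ i) ⟩
    π n′ j * P n′ b j i * 1ℚ                 ≡⟨ ℚ.*-identityʳ _ ⟩
    π n′ j * P n′ b j i                      ∎
    where open ≡-Reasoning

  reversal-K : ∀ i j → reversal (π n′) π-nonZero K i j ≡ P n′ b i j
  reversal-K i j = begin
    π n′ j * K j i * π⁻¹ i        ≡⟨ cong (_* π⁻¹ i) (π*K j i) ⟩
    π n′ i * P n′ b i j * π⁻¹ i   ≡⟨ cong (_* π⁻¹ i) (ℚ.*-comm (π n′ i) _) ⟩
    P n′ b i j * π n′ i * π⁻¹ i   ≡⟨ ℚ.*-assoc (P n′ b i j) (π n′ i) (π⁻¹ i) ⟩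
    P n′ b i j * (π n′ i * π⁻¹ i) ≡⟨ cong (P n′ b i j *_) (π*π⁻¹ i) ⟩
    P n′ b i j * 1ℚ               ≡⟨ ℚ.*-identityʳ (P n′ b i j) ⟩
    P n′ b i j                    ∎
    where open ≡-Reasoning

  -- Reversal exchanges the two conditions: π is invariant under K because the rows of P_b sum to
  -- one, and in `K-stochastic` the rows of K sum to one because π is invariant under P_b.
  π-isStationary : IsStationary (π n′) K
  π-isStationary = record
    { isDistribution = π-isDistribution
    ; invariant = λ j → begin
        sum (λ i → π n′ i * K i j)                  ≡⟨ sum-∑ n′ _ ⟩
        ∑ (allFin n′) (λ i → π n′ i * K i j)        ≡⟨ ∑-cong (allFin n′) (λ i → π*K i j) ⟩
        ∑ (allFin n′) (λ i → π n′ j * P n′ b j i)   ≡⟨ ⊗-∑ (π n′ j) (allFin n′) _ ⟨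
        π n′ j * ∑ (allFin n′) (P n′ b j)
          ≡⟨ cong (π n′ j *_) (trans (sym (sum-∑ n′ _))
            (IsDistribution.total (P-stochastic j))) ⟩
        π n′ j * 1ℚ                                 ≡⟨ ℚ.*-identityʳ (π n′ j) ⟩
        π n′ j                                      ∎
    }
    where open ≡-Reasoning

  K-stochastic : ∀ i → IsDistribution (K i)
  K-stochastic i = record
    { nonNegative = λ j → nonNeg* (nonNeg* (IsDistribution.nonNegative π-isDistribution j)
        (IsDistribution.nonNegative (P-stochastic j) i)) π⁻¹-nonNegative
    ; total = begin
        sum (K i)                                             ≡⟨ sum-∑ n′ (K i) ⟩
        ∑ (allFin n′) (λ j → π n′ j * P n′ b j i * π⁻¹ i)     ≡⟨ ∑-⊗ (allFin n′) _ (π⁻¹ i) ⟨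
        ∑ (allFin n′) (λ j → π n′ j * P n′ b j i) * π⁻¹ i     ≡⟨ cong (_* π⁻¹ i) (π-invariant-P i) ⟩
        π n′ i * π⁻¹ i                                        ≡⟨ π*π⁻¹ i ⟩
        1ℚ                                                    ∎
    }
    where
    open ≡-Reasoning
    nonNeg* : ∀ {p q} → 0ℚ ℚ.≤ p → 0ℚ ℚ.≤ q → 0ℚ ℚ.≤ p * q
    nonNeg* {p} {q} 0≤p 0≤q = subst (ℚ._≤ p * q) (ℚ.*-zeroʳ p)
      (ℚ.*-monoˡ-≤-nonNeg p {{ℚ.nonNegative 0≤p}} 0≤q)
    π-positive : ℚ.Positive (π n′ i)
    π-positive = ℚ.normalize-pos (eulerian n′ (toℕ i)) (n′ !) {{n!≢0}} {{ℕ.>-nonZero (eulerian>0 i)}}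
    π⁻¹-nonNegative : 0ℚ ℚ.≤ π⁻¹ i
    π⁻¹-nonNegative = ℚ.<⇒≤ (ℚ.positive⁻¹ (π⁻¹ i) {{ℚ.1/pos⇒pos (π n′ i) {{π-positive}}}})

  -- The uniform law on a descent class

  private
    -- The factor `π⁻¹ i * ω` is 1/A(n,i), so this is the mean of φ over the τ with d(τ⁻¹) = i.
    average : Fin n′ → (Permutation′ n′ → ℚ) → ℚ
    average i φ = π⁻¹ i * ω * ∑ Sₙ (λ τ → ⟦ descentsOf⁻¹ τ Fin.≟ i ⟧ * φ τ)

    average-cong : ∀ i {φ ψ} → (∀ τ → φ τ ≡ ψ τ) → average i φ ≡ average i ψ
    average-cong i eq = cong (π⁻¹ i * ω *_) (∑-cong Sₙ λ τ → cong (⟦ descentsOf⁻¹ τ Fin.≟ i ⟧ *_) (eq τ))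

    average-one : ∀ i → average i (λ _ → 1ℚ) ≡ 1ℚ
    average-one i = begin
      π⁻¹ i * ω * ∑ Sₙ (λ τ → ⟦ descentsOf⁻¹ τ Fin.≟ i ⟧ * 1ℚ)
        ≡⟨ cong (π⁻¹ i * ω *_) (∑-cong Sₙ λ τ → ℚ.*-identityʳ _) ⟩
      π⁻¹ i * ω * ∑ Sₙ (λ τ → ⟦ descentsOf⁻¹ τ Fin.≟ i ⟧)       ≡⟨ ℚ.*-assoc (π⁻¹ i) ω _ ⟩
      π⁻¹ i * (ω * ∑ Sₙ (λ τ → ⟦ descentsOf⁻¹ τ Fin.≟ i ⟧))     ≡⟨ cong (π⁻¹ i *_) (π-∑ i) ⟨
      π⁻¹ i * π n′ i                                            ≡⟨ ℚ.*-comm (π⁻¹ i) (π n′ i) ⟩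
      π n′ i * π⁻¹ i                                            ≡⟨ π*π⁻¹ i ⟩
      1ℚ                                                        ∎
      where open ≡-Reasoning

    average-obs : ∀ i φ → average i (λ τ → ⟦ descentsOf⁻¹ τ Fin.≟ i ⟧ * φ τ) ≡ average i φ
    average-obs i φ = cong (π⁻¹ i * ω *_) (∑-cong Sₙ λ τ → ⟦⟧-idem (descentsOf⁻¹ τ Fin.≟ i) (φ τ))

    average-id : ∀ φ → (∀ σ τ → σ Perm.≈ τ → φ σ ≡ φ τ) → φ Perm.id ≡ average (descentsOf⁻¹ Perm.id) φ
    average-id φ φ-cong = begin
      φ Perm.id                                                          ≡⟨ ℚ.*-identityˡ (φ Perm.id) ⟨
      1ℚ * φ Perm.id
        -- That the factor `π⁻¹ 0ᵈ * ω` is one, that is A(n,0) = 1, is read off from the average of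
        -- the constant 1 over this one-point class.
        ≡⟨ cong (_* φ Perm.id) (average-one 0ᵈ) ⟨
      average 0ᵈ (λ _ → 1ℚ) * φ Perm.id
        ≡⟨ cong (λ q → π⁻¹ 0ᵈ * ω * q * φ Perm.id) (only-id (λ _ → 1ℚ) (λ _ _ _ → refl)) ⟩
      π⁻¹ 0ᵈ * ω * 1ℚ * φ Perm.id
        ≡⟨ cong (_* φ Perm.id) (ℚ.*-identityʳ (π⁻¹ 0ᵈ * ω)) ⟩
      π⁻¹ 0ᵈ * ω * φ Perm.id
        ≡⟨ cong (π⁻¹ 0ᵈ * ω *_) (only-id φ φ-cong) ⟨
      average 0ᵈ φ                                                       ∎
      where
      open ≡-Reasoning
      0ᵈ : Fin n′
      0ᵈ = descentsOf⁻¹ Perm.id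
      d-flip-id : d (flip (Perm.id {n′})) ≡ 0
      d-flip-id = trans (d-cong {σ = flip (Perm.id {n′})} {Perm.id} λ _ → refl) (d-id {n′})
      id-only : ∀ τ → descentsOf⁻¹ τ ≡ 0ᵈ → τ Perm.≈ Perm.id
      id-only τ eq i = trans (cong (τ ⟨$⟩ʳ_) (sym (d≡0⇒id (flip τ) (trans (sym (Fin.toℕ-fromℕ< (d<n (flip τ))))
        (trans (cong toℕ eq) (trans (Fin.toℕ-fromℕ< (d<n (flip Perm.id))) d-flip-id))) i))) (inverseʳ τ)
      only-id : ∀ ψ → (∀ σ τ → σ Perm.≈ τ → ψ σ ≡ ψ τ) →
                ∑ Sₙ (λ τ → ⟦ descentsOf⁻¹ τ Fin.≟ 0ᵈ ⟧ * ψ τ) ≡ ψ Perm.id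
      only-id ψ ψ-cong = trans
        (∑-cong Sₙ λ τ → cong (_* ψ τ) (⟦⟧-cong (descentsOf⁻¹ τ Fin.≟ 0ᵈ) (τ ≈? Perm.id)
          (id-only τ) (descentsOf⁻¹-cong {τ} {Perm.id})))
        (∑-select _≈?_ (perms-enumerate n′) ψ-cong Perm.id)

    -- With the new arrangement t fixed, the sum over the old ones in class i is P_b(d(t⁻¹), i) by
    -- `P-shuffles`. It is constant on class j, so what is left is again an unweighted sum over
    -- class j; the two normalizations A(n,i) and A(n,j) leave π(j)/π(i), the factor in K.
    average-step : ∀ i j φ → (∀ σ τ → σ Perm.≈ τ → φ σ ≡ φ τ) →
      average i (λ s → ∑ Sₙ λ μ → Q n′ b μ * (⟦ descentsOf⁻¹ (shuffle s μ) Fin.≟ j ⟧ * φ (shuffle s μ)))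
      ≡ K i j * average j φ
    average-step i j φ φ-cong = begin
      π⁻¹ i * ω * ∑ Sₙ (λ s → I s * ∑ Sₙ λ μ → Q n′ b μ * ψ (μ ∘ₚ s))
        ≡⟨ cong (π⁻¹ i * ω *_) (∑-cong Sₙ λ s → cong (I s *_) (trans
             -- The shuffle is written as s⁻¹ t with t = s μ, so that translation by s makes t the
             -- summation variable.
             (∑-cong Sₙ λ μ → cong (_* ψ (μ ∘ₚ s)) (Q-cong {μ} {(μ ∘ₚ s) ∘ₚ flip s} λ _ → sym (inverseˡ s)))
             (∑-translate s (g-cong s)))) ⟩
      π⁻¹ i * ω * ∑ Sₙ (λ s → I s * ∑ Sₙ λ t → Q n′ b (t ∘ₚ flip s) * ψ t)
        ≡⟨ cong (π⁻¹ i * ω *_) (trans (∑-cong Sₙ λ s → ⊗-∑ (I s) Sₙ _) (∑-swap Sₙ Sₙ _)) ⟩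
      π⁻¹ i * ω * ∑ Sₙ (λ t → ∑ Sₙ λ s → I s * (Q n′ b (t ∘ₚ flip s) * ψ t))
        ≡⟨ cong (π⁻¹ i * ω *_) (∑-cong Sₙ λ t → trans
             (∑-cong Sₙ λ s → trans (sym (ℚ.*-assoc (I s) (Q n′ b (t ∘ₚ flip s)) (ψ t)))
               (cong (_* ψ t) (ℚ.*-comm (I s) (Q n′ b (t ∘ₚ flip s)))))
             (trans (sym (∑-⊗ Sₙ (λ s → Q n′ b (t ∘ₚ flip s) * I s) (ψ t))) (cong (_* ψ t) (sym (P-shuffles t i))))) ⟩
      π⁻¹ i * ω * ∑ Sₙ (λ t → P n′ b (descentsOf⁻¹ t) i * ψ t)
        ≡⟨ cong (π⁻¹ i * ω *_) (∑-cong Sₙ λ t → trans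
             (*-left-comm (P n′ b (descentsOf⁻¹ t) i) ⟦ descentsOf⁻¹ t Fin.≟ j ⟧ (φ t)) (trans
             (⟦⟧-⊗-cong (descentsOf⁻¹ t Fin.≟ j) (λ eq → cong (λ k → P n′ b k i * φ t) eq))
             (*-left-comm ⟦ descentsOf⁻¹ t Fin.≟ j ⟧ (P n′ b j i) (φ t)))) ⟩
      π⁻¹ i * ω * ∑ Sₙ (λ t → P n′ b j i * ψ t)
        ≡⟨ cong (π⁻¹ i * ω *_) (⊗-∑ (P n′ b j i) Sₙ _) ⟨
      π⁻¹ i * ω * (P n′ b j i * ∑ Sₙ ψ)
        ≡⟨ regroup ⟩
      K i j * average j φ ∎
      where
      open ≡-Reasoning
      I = λ s → ⟦ descentsOf⁻¹ s Fin.≟ i ⟧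
      ψ : Permutation′ n′ → ℚ
      ψ t = ⟦ descentsOf⁻¹ t Fin.≟ j ⟧ * φ t
      g-cong : ∀ s σ τ → σ Perm.≈ τ → Q n′ b (σ ∘ₚ flip s) * ψ σ ≡ Q n′ b (τ ∘ₚ flip s) * ψ τ
      g-cong s σ τ eq = cong₂ _*_
        (Q-cong {σ ∘ₚ flip s} {τ ∘ₚ flip s} (λ k → cong (s ⟨$⟩ˡ_) (eq k)))
        (cong₂ (λ k q → ⟦ k Fin.≟ j ⟧ * q) (descentsOf⁻¹-cong {σ} {τ} eq) (φ-cong σ τ eq))
      p = P n′ b j i
      regroup : π⁻¹ i * ω * (p * ∑ Sₙ ψ) ≡ K i j * average j φ
      regroup = begin
        π⁻¹ i * ω * (p * ∑ Sₙ ψ)                            ≡⟨ ℚ.*-assoc (π⁻¹ i) ω _ ⟩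
        π⁻¹ i * (ω * (p * ∑ Sₙ ψ))                          ≡⟨ cong (π⁻¹ i *_) (*-left-comm ω p (∑ Sₙ ψ)) ⟩
        π⁻¹ i * (p * (ω * ∑ Sₙ ψ))
          ≡⟨ cong (λ q → π⁻¹ i * (p * q)) (ℚ.*-identityˡ (ω * ∑ Sₙ ψ)) ⟨
        -- The 1 becomes π(j) π(j)⁻¹: one factor completes K(i,j), the other normalizes the average
        -- over class j.
        π⁻¹ i * (p * (1ℚ * (ω * ∑ Sₙ ψ)))
          ≡⟨ cong (λ q → π⁻¹ i * (p * (q * (ω * ∑ Sₙ ψ)))) (π*π⁻¹ j) ⟨
        π⁻¹ i * (p * (π n′ j * π⁻¹ j * (ω * ∑ Sₙ ψ)))
          ≡⟨ cong (λ q → π⁻¹ i * (p * q)) (trans (ℚ.*-assoc (π n′ j) (π⁻¹ j) _)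
                                                               (cong (π n′ j *_) (sym (ℚ.*-assoc (π⁻¹ j) ω _)))) ⟩
        π⁻¹ i * (p * (π n′ j * average j φ))
          ≡⟨ cong (π⁻¹ i *_) (trans
            (*-left-comm p (π n′ j) _) (sym (ℚ.*-assoc (π n′ j) p _))) ⟩
        π⁻¹ i * (π n′ j * p * average j φ)                  ≡⟨ ℚ.*-assoc (π⁻¹ i) (π n′ j * p) _ ⟨
        π⁻¹ i * (π n′ j * p) * average j φ
          ≡⟨ cong (_* average j φ) (ℚ.*-comm (π⁻¹ i) (π n′ j * p)) ⟩
        K i j * average j φ                                 ∎

  shuffleDescents-isMarkovChain : IsMarkovChain (shuffleDescents n′ b) K
  shuffleDescents-isMarkovChain = driven-isMarkovChain (shuffleLaw n′ b) shuffle descentsOf⁻¹ {_~_ = Perm._≈_}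
    (λ σ τ → descentsOf⁻¹-cong {σ} {τ}) (λ _ _ μ eq i → eq (μ ⟨$⟩ʳ i))
    Perm.id K average average-cong average-one average-obs average-id average-step K-stochastic

theorem2p2 : (n b : ℕ) .{{_ : NonZero n}} .{{_ : NonZero b}} → 2 ≤ n → 2 ≤ b →
    ∃[ K ] (IsMarkovChain (shuffleDescents n b) K
    × IsStationary (π n) K
    × (∀ i j → K i j ≡ ((π n j * P n b j i) ÷ π n i) {{π-nonZero i}})
    × (∀ i j → reversal (π n) π-nonZero K i j ≡ P n b i j)
    × IsMarkovChain (carries n b) (P n b))
theorem2p2 (suc m) b _ _ =
  K m b , shuffleDescents-isMarkovChain m b , π-isStationary m b ,
  (λ _ _ → refl) , reversal-K m b , carries-isMarkovChain m b
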